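{- Let $G$ be an $n$-vertex graph, let $s$ be a non-negative integer and let $\varepsilon\le 2^{ -5}$. Then one can delete at most $4sn\log n$ edges from $G$ so that the remaining edges may be partitioned into (edge-disjoint) graphs $G_1,\ldots,G_r$ (subgraphs of $G$) such that $\sum_{i=1}^r |G_i|\le 2n$ and each $G_i$ is an $(\varepsilon,s)$-expander.
   Context: Graphs are finite and simple; logarithms have base two and $\log^k n=(\log n)^k$. $|H|$ denotes the number of vertices of a graph $H$. For a graph $G$ and $F\subseteq E(G)$, $G-F$ is $G$ with the edges of $F$ deleted. $N_G(U)$ is the set of vertices in $V(G)\setminus U$ with a neighbour in $U$. An $n$-vertex graph $G$ is an $(\varepsilon,s)$-expander if, for every $U\subseteq V(G)$ and $F\subseteq E(G)$ with $1\le|U|\le\frac23 n$ and $|F|\le s|U|$, we have $|N_{G-F}(U)|\ge \frac{\varepsilon|U|}{\log^2 n}$. (In particular every $1$-vertex graph is trivially an $(\varepsilon,s)$-expander.) -}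

module Defs where

open import Data.Bool using (Bool; false; _∧_; not; T)
open import Data.Bool.Properties using (T?; T-∧)
open import Data.Fin using (Fin)
import Data.Fin.Properties as Fin
open import Data.Fin.Subset using (Subset; _∈_; _⊆_; ∣_∣)
open import Data.Fin.Subset.Properties using (_∈?_)
open import Data.Integer as ℤ using (+_)
import Data.Integer.Properties as ℤ
open import Data.Integer.Solver using () renaming (module +-*-Solver to ℤ-Solver)
open import Data.List using (length; filter; allFin; cartesianProduct)
open import Data.Nat
open import Data.Nat.Induction using (<-rec)
open import Data.Nat.Logarithm using (⌊log₂_⌋; ⌊log₂⌋-mono-≤; ⌊log₂[2^n]⌋≡n; ⌊log₂⌊n/2⌋⌋≡⌊log₂n⌋∸1)
open import Data.Nat.Properties
open import Data.Product using (_×_; _,_; proj₁; ∃-syntax; ∃!)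
open import Data.Rational as ℚ using (ℚ; 0ℚ; 1ℚ)
import Data.Rational.Properties as ℚ
open import Data.Rational.Solver using (module +-*-Solver)
import Data.Rational.Unnormalised as ℚᵘ
import Data.Rational.Unnormalised.Properties as ℚᵘ
open import Data.Sum using (inj₁; inj₂)
open import Data.Vec using (tabulate)
open import Data.Vec.Functional using (Vector)
open import Function using (_∘_; Equivalence)
open import Relation.Binary.PropositionalEquality
open import Relation.Nullary using (does; ¬?; _×-dec_; contradiction)

record ℝ : Set where
  field
    approx : ℕ → ℚ
    cauchy : ∀ δ → 0ℚ ℚ.< δ →
             ∃[ N ] (∀ {j k} → N ≤ j → N ≤ k → ℚ.∣ approx j ℚ.- approx k ∣ ℚ.≤ δ)

open ℝ

infix 4 _≤ℝ_

_≤ℝ_ : ℝ → ℝ → Set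
x ≤ℝ y = ∀ δ → 0ℚ ℚ.< δ → ∃[ N ] (∀ {k} → N ≤ k → approx x k ℚ.≤ approx y k ℚ.+ δ)

0<ℝ_ : ℝ → Set
0<ℝ x = ∃[ δ ] (0ℚ ℚ.< δ × ∃[ N ] (∀ {k} → N ≤ k → δ ℚ.≤ approx x k))

fromℚ : ℚ → ℝ
fromℚ q .approx _ = q
fromℚ q .cauchy δ 0<δ = 0 , λ _ _ → subst (ℚ._≤ δ) (sym (cong ℚ.∣_∣ (ℚ.+-inverseʳ q))) (ℚ.<⇒≤ 0<δ)

fromℕ : ℕ → ℝ
fromℕ n = fromℚ (+ n ℚ./ 1)

module ℚ-Lemmas where
  pos : ∀ {p} → 0ℚ ℚ.< p → ℚ.Positive p
  pos = ℚ.positive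

  0<* : ∀ {p q} → 0ℚ ℚ.< p → 0ℚ ℚ.< q → 0ℚ ℚ.< p ℚ.* q
  0<* {p} {q} 0<p 0<q = subst (ℚ._< p ℚ.* q) (ℚ.*-zeroʳ p) (ℚ.*-monoʳ-<-pos p {{pos 0<p}} 0<q)

  *-mono-≤-nonNeg : ∀ {a b c d} → 0ℚ ℚ.≤ a → 0ℚ ℚ.≤ d → a ℚ.≤ b → c ℚ.≤ d → a ℚ.* c ℚ.≤ b ℚ.* d
  *-mono-≤-nonNeg {a} {b} {c} {d} 0≤a 0≤d a≤b c≤d =
    ℚ.≤-trans (ℚ.*-monoˡ-≤-nonNeg a {{ℚ.nonNegative 0≤a}} c≤d)
              (ℚ.*-monoʳ-≤-nonNeg d {{ℚ.nonNegative 0≤d}} a≤b)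

  module _ where
    open +-*-Solver

    *-diff : ∀ a b c d → a ℚ.* b ℚ.- c ℚ.* d ≡ a ℚ.* (b ℚ.- d) ℚ.+ (a ℚ.- c) ℚ.* d
    *-diff = solve 4 (λ a b c d → a :* b :- c :* d := a :* (b :- d) :+ (a :- c) :* d) refl

    *-collect : ∀ a b d → a ℚ.* d ℚ.+ d ℚ.* b ≡ (a ℚ.+ b) ℚ.* d
    *-collect = solve 3 (λ a b d → a :* d :+ d :* b := (a :+ b) :* d) refl

    1/-diff : ∀ a b c d → a ℚ.* (b ℚ.* c) ℚ.- b ℚ.* (a ℚ.* d) ≡ (a ℚ.* b) ℚ.* (c ℚ.- d)
    1/-diff = solve 4 (λ a b c d → a :* (b :* c) :- b :* (a :* d) := (a :* b) :* (c :- d)) refl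

    1/-regroup : ∀ a b e d → (a ℚ.* b) ℚ.* (e ℚ.* (d ℚ.* d)) ≡ e ℚ.* ((a ℚ.* d) ℚ.* (b ℚ.* d))
    1/-regroup = solve 4 (λ a b e d → (a :* b) :* (e :* (d :* d)) := e :* ((a :* d) :* (b :* d))) refl

    swap : ∀ k d i → k ℚ.* (d ℚ.* i) ≡ d ℚ.* (k ℚ.* i)
    swap = solve 3 (λ k d i → k :* (d :* i) := d :* (k :* i)) refl

    -+-cancel : ∀ a b → a ≡ (a ℚ.- b) ℚ.+ b
    -+-cancel = solve 2 (λ a b → a := (a :- b) :+ b) refl

    +--cancel : ∀ b d → (b ℚ.+ d) ℚ.- b ≡ d
    +--cancel = solve 2 (λ b d → (b :+ d) :- b := d) refl

    neg-diff : ∀ a b → b ℚ.- a ≡ ℚ.- (a ℚ.- b)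
    neg-diff = solve 2 (λ a b → b :- a := :- (a :- b)) refl

  *-1/-cancel : ∀ δ K .{{_ : ℚ.NonZero K}} → K ℚ.* (δ ℚ.* ℚ.1/ K) ≡ δ
  *-1/-cancel δ K = begin
    K ℚ.* (δ ℚ.* ℚ.1/ K)  ≡⟨ swap K δ (ℚ.1/ K) ⟩
    δ ℚ.* (K ℚ.* ℚ.1/ K)  ≡⟨ cong (δ ℚ.*_) (ℚ.*-inverseʳ K) ⟩
    δ ℚ.* 1ℚ              ≡⟨ ℚ.*-identityʳ δ ⟩
    δ                     ∎
    where open ≡-Reasoning

  *-close : ∀ {A B η} a b c d → 0ℚ ℚ.≤ B → 0ℚ ℚ.≤ η →
            ℚ.∣ a ∣ ℚ.≤ A → ℚ.∣ d ∣ ℚ.≤ B → ℚ.∣ a ℚ.- c ∣ ℚ.≤ η → ℚ.∣ b ℚ.- d ∣ ℚ.≤ η →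
            ℚ.∣ a ℚ.* b ℚ.- c ℚ.* d ∣ ℚ.≤ (A ℚ.+ B) ℚ.* η
  *-close {A} {B} {η} a b c d 0≤B 0≤η a≤A d≤B a-c≤η b-d≤η = begin
    ℚ.∣ a ℚ.* b ℚ.- c ℚ.* d ∣
      ≡⟨ cong ℚ.∣_∣ (*-diff a b c d) ⟩
    ℚ.∣ a ℚ.* (b ℚ.- d) ℚ.+ (a ℚ.- c) ℚ.* d ∣
      ≤⟨ ℚ.∣p+q∣≤∣p∣+∣q∣ (a ℚ.* (b ℚ.- d)) ((a ℚ.- c) ℚ.* d) ⟩
    ℚ.∣ a ℚ.* (b ℚ.- d) ∣ ℚ.+ ℚ.∣ (a ℚ.- c) ℚ.* d ∣
      ≡⟨ cong₂ ℚ._+_ (ℚ.∣p*q∣≡∣p∣*∣q∣ a (b ℚ.- d)) (ℚ.∣p*q∣≡∣p∣*∣q∣ (a ℚ.- c) d) ⟩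
    ℚ.∣ a ∣ ℚ.* ℚ.∣ b ℚ.- d ∣ ℚ.+ ℚ.∣ a ℚ.- c ∣ ℚ.* ℚ.∣ d ∣
      ≤⟨ ℚ.+-mono-≤ (*-mono-≤-nonNeg (ℚ.0≤∣p∣ a) 0≤η a≤A b-d≤η)
                    (*-mono-≤-nonNeg (ℚ.0≤∣p∣ (a ℚ.- c)) 0≤B a-c≤η d≤B) ⟩
    A ℚ.* η ℚ.+ η ℚ.* B
      ≡⟨ *-collect A B η ⟩
    (A ℚ.+ B) ℚ.* η ∎
    where open ℚ.≤-Reasoning

  split : ∀ K δ → 0ℚ ℚ.< K → 0ℚ ℚ.< δ → ∃[ η ] (0ℚ ℚ.< η × K ℚ.* η ≡ δ)
  split K δ 0<K 0<δ = δ ℚ.* ℚ.1/ K , 0<* 0<δ (ℚ.positive⁻¹ (ℚ.1/ K) {{ℚ.1/pos⇒pos K {{pos 0<K}}}}) , *-1/-cancel δ K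
    where instance _ = ℚ.pos⇒nonZero K {{pos 0<K}}

  bounded : ∀ x → ∃[ K ] (0ℚ ℚ.< K × ∃[ N ] (∀ {k} → N ≤ k → ℚ.∣ approx x k ∣ ℚ.≤ K))
  bounded x with cauchy x 1ℚ (ℚ.positive⁻¹ 1ℚ)
  ... | N , close = K , 0<K , N , bound
    where
    K = 1ℚ ℚ.+ ℚ.∣ approx x N ∣

    0<K : 0ℚ ℚ.< K
    0<K = ℚ.+-mono-<-≤ (ℚ.positive⁻¹ 1ℚ) (ℚ.0≤∣p∣ (approx x N))

    bound : ∀ {k} → N ≤ k → ℚ.∣ approx x k ∣ ℚ.≤ K
    bound {k} N≤k = begin
      ℚ.∣ xₖ ∣                                     ≡⟨ cong ℚ.∣_∣ (-+-cancel xₖ (approx x N)) ⟩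
      ℚ.∣ (xₖ ℚ.- approx x N) ℚ.+ approx x N ∣    ≤⟨ ℚ.∣p+q∣≤∣p∣+∣q∣ (xₖ ℚ.- approx x N) (approx x N) ⟩
      ℚ.∣ xₖ ℚ.- approx x N ∣ ℚ.+ ℚ.∣ approx x N ∣ ≤⟨ ℚ.+-monoˡ-≤ ℚ.∣ approx x N ∣ (close N≤k ≤-refl) ⟩
      K                                            ∎
      where open ℚ.≤-Reasoning
            xₖ = approx x k

open ℚ-Lemmas

infixl 7 _*ℝ_

_*ℝ_ : ℝ → ℝ → ℝ
(x *ℝ y) .approx k = approx x k ℚ.* approx y k
(x *ℝ y) .cauchy δ 0<δ =
  let A , 0<A , N₁ , ∣x∣≤A = bounded x
      B , 0<B , N₂ , ∣y∣≤B = bounded y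
      η , 0<η , Kη≡δ = split (A ℚ.+ B) δ (ℚ.+-mono-< 0<A 0<B) 0<δ
      M₁ , x-close = cauchy x η 0<η
      M₂ , y-close = cauchy y η 0<η
  in (N₁ ⊔ N₂) ⊔ (M₁ ⊔ M₂) , λ {j} {k} ≤j ≤k →
    let N≤j = m⊔n≤o⇒m≤o (N₁ ⊔ N₂) (M₁ ⊔ M₂) ≤j
        N≤k = m⊔n≤o⇒m≤o (N₁ ⊔ N₂) (M₁ ⊔ M₂) ≤k
        M≤j = m⊔n≤o⇒n≤o (N₁ ⊔ N₂) (M₁ ⊔ M₂) ≤j
        M≤k = m⊔n≤o⇒n≤o (N₁ ⊔ N₂) (M₁ ⊔ M₂) ≤k
    in subst (_ ℚ.≤_) Kη≡δ
      (*-close (approx x j) (approx y j) (approx x k) (approx y k) (ℚ.<⇒≤ 0<B) (ℚ.<⇒≤ 0<η)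
        (∣x∣≤A (m⊔n≤o⇒m≤o N₁ N₂ N≤j)) (∣y∣≤B (m⊔n≤o⇒n≤o N₁ N₂ N≤k))
        (x-close (m⊔n≤o⇒m≤o M₁ M₂ M≤j) (m⊔n≤o⇒m≤o M₁ M₂ M≤k))
        (y-close (m⊔n≤o⇒n≤o M₁ M₂ M≤j) (m⊔n≤o⇒n≤o M₁ M₂ M≤k)))

-- The cut-off  _⊔ δ  makes every term invertible; it is inactive from the
-- index in the positivity witness onwards, so the value does not depend on
-- the witness.

1/ℝ : (x : ℝ) → 0<ℝ x → ℝ
1/ℝ x (δ , 0<δ , N , δ≤x) = record { approx = r ; cauchy = r-cauchy }
  where
  t : ℕ → ℚ
  t k = approx x k ℚ.⊔ δ

  0<t : ∀ k → 0ℚ ℚ.< t k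
  0<t k = ℚ.<-≤-trans 0<δ (ℚ.p≤q⊔p (approx x k) δ)

  t≢0 : ∀ k → ℚ.NonZero (t k)
  t≢0 k = ℚ.pos⇒nonZero (t k) {{pos (0<t k)}}

  r : ℕ → ℚ
  r k = (ℚ.1/ t k) {{t≢0 k}}

  0<r : ∀ k → 0ℚ ℚ.< r k
  0<r k = ℚ.positive⁻¹ (r k) {{ℚ.1/pos⇒pos (t k) {{pos (0<t k)}}}}

  rt≡1 : ∀ k → r k ℚ.* t k ≡ 1ℚ
  rt≡1 k = ℚ.*-inverseˡ (t k) {{t≢0 k}}

  rδ≤1 : ∀ k → r k ℚ.* δ ℚ.≤ 1ℚ
  rδ≤1 k = subst (r k ℚ.* δ ℚ.≤_) (rt≡1 k)
    (ℚ.*-monoˡ-≤-nonNeg (r k) {{ℚ.nonNegative (ℚ.<⇒≤ (0<r k))}} (ℚ.p≤q⊔p (approx x k) δ))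

  r-diff : ∀ j k → r j ℚ.- r k ≡ (r j ℚ.* r k) ℚ.* (t k ℚ.- t j)
  r-diff j k = begin
    r j ℚ.- r k
      ≡⟨ cong₂ ℚ._-_ (sym (ℚ.*-identityʳ (r j))) (sym (ℚ.*-identityʳ (r k))) ⟩
    r j ℚ.* 1ℚ ℚ.- r k ℚ.* 1ℚ
      ≡⟨ cong₂ (λ a b → r j ℚ.* a ℚ.- r k ℚ.* b) (sym (rt≡1 k)) (sym (rt≡1 j)) ⟩
    r j ℚ.* (r k ℚ.* t k) ℚ.- r k ℚ.* (r j ℚ.* t j)
      ≡⟨ 1/-diff (r j) (r k) (t k) (t j) ⟩
    (r j ℚ.* r k) ℚ.* (t k ℚ.- t j) ∎
    where open ≡-Reasoning

  r-cauchy : ∀ η → 0ℚ ℚ.< η →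
             ∃[ M ] (∀ {j k} → M ≤ j → M ≤ k → ℚ.∣ r j ℚ.- r k ∣ ℚ.≤ η)
  r-cauchy η 0<η =
    let M , x-close = cauchy x (η ℚ.* (δ ℚ.* δ)) (0<* 0<η (0<* 0<δ 0<δ)) in
    N ⊔ M , λ {j} {k} ≤j ≤k →
      let t≡x : ∀ {i} → N ⊔ M ≤ i → t i ≡ approx x i
          t≡x ≤i = ℚ.p≥q⇒p⊔q≡p (δ≤x (m⊔n≤o⇒m≤o N M ≤i))
          0≤rr = ℚ.<⇒≤ (0<* (0<r j) (0<r k)) in begin
      ℚ.∣ r j ℚ.- r k ∣
        ≡⟨ cong ℚ.∣_∣ (r-diff j k) ⟩
      ℚ.∣ (r j ℚ.* r k) ℚ.* (t k ℚ.- t j) ∣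
        ≡⟨ ℚ.∣p*q∣≡∣p∣*∣q∣ (r j ℚ.* r k) (t k ℚ.- t j) ⟩
      ℚ.∣ r j ℚ.* r k ∣ ℚ.* ℚ.∣ t k ℚ.- t j ∣
        ≡⟨ cong₂ ℚ._*_ (ℚ.0≤p⇒∣p∣≡p 0≤rr) (cong₂ (λ a b → ℚ.∣ a ℚ.- b ∣) (t≡x ≤k) (t≡x ≤j)) ⟩
      (r j ℚ.* r k) ℚ.* ℚ.∣ approx x k ℚ.- approx x j ∣
        ≤⟨ ℚ.*-monoˡ-≤-nonNeg (r j ℚ.* r k) {{ℚ.nonNegative 0≤rr}}
             (x-close (m⊔n≤o⇒n≤o N M ≤k) (m⊔n≤o⇒n≤o N M ≤j)) ⟩
      (r j ℚ.* r k) ℚ.* (η ℚ.* (δ ℚ.* δ))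
        ≡⟨ 1/-regroup (r j) (r k) η δ ⟩
      η ℚ.* ((r j ℚ.* δ) ℚ.* (r k ℚ.* δ))
        ≤⟨ ℚ.*-monoˡ-≤-nonNeg η {{ℚ.nonNegative (ℚ.<⇒≤ 0<η)}}
             (*-mono-≤-nonNeg (ℚ.<⇒≤ (0<* (0<r j) 0<δ)) (ℚ.<⇒≤ (ℚ.positive⁻¹ 1ℚ)) (rδ≤1 j) (rδ≤1 k)) ⟩
      η ℚ.* (1ℚ ℚ.* 1ℚ)
        ≡⟨ ℚ.*-identityʳ η ⟩
      η ∎
    where open ℚ.≤-Reasoning

module Log-Lemmas where
  2^⌊log₂⌋≤ : ∀ n → 1 ≤ n → 2 ^ ⌊log₂ n ⌋ ≤ n
  2^⌊log₂⌋≤ = <-rec _ step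
    where
    step : ∀ n → (∀ {m} → m < n → 1 ≤ m → 2 ^ ⌊log₂ m ⌋ ≤ m) → 1 ≤ n → 2 ^ ⌊log₂ n ⌋ ≤ n
    step 1 _ _ = ≤-refl
    step n@(suc (suc k)) rec _ = begin
      2 ^ ⌊log₂ n ⌋              ≡⟨ cong (2 ^_) (sym (m+[n∸m]≡n (⌊log₂⌋-mono-≤ {2} {n} (s≤s (s≤s z≤n))))) ⟩
      2 * 2 ^ (⌊log₂ n ⌋ ∸ 1)    ≡⟨ cong (λ e → 2 * 2 ^ e) (sym (⌊log₂⌊n/2⌋⌋≡⌊log₂n⌋∸1 n)) ⟩
      2 * 2 ^ ⌊log₂ h ⌋          ≤⟨ *-monoʳ-≤ 2 (rec (⌊n/2⌋<n (suc k)) (s≤s z≤n)) ⟩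
      2 * h                      ≡⟨ cong (λ m → h + m) (+-identityʳ h) ⟩
      h + h                      ≤⟨ +-monoʳ-≤ h (⌊n/2⌋≤⌈n/2⌉ n) ⟩
      h + ⌈ n /2⌉                ≡⟨ ⌊n/2⌋+⌈n/2⌉≡n n ⟩
      n                          ∎
      where open ≤-Reasoning
            h = ⌊ n /2⌋

  <2^1+⌊log₂⌋ : ∀ n → n < 2 ^ suc ⌊log₂ n ⌋
  <2^1+⌊log₂⌋ n = ≰⇒> λ 2^≤n →
    1+n≰n (subst (_≤ ⌊log₂ n ⌋) (⌊log₂[2^n]⌋≡n (suc ⌊log₂ n ⌋)) (⌊log₂⌋-mono-≤ 2^≤n))

  ^-cancel-≤ : ∀ a b → 2 ^ a ≤ 2 ^ b → a ≤ b
  ^-cancel-≤ a b 2^a≤2^b = ≮⇒≥ λ b<a →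
    <⇒≱ (^-monoʳ-< 2 (s≤s (s≤s z≤n)) b<a) 2^a≤2^b

  ⌊log₂⌋-cross : ∀ n p q → ⌊log₂ (n ^ suc p) ⌋ * suc q ≤ suc ⌊log₂ (n ^ suc q) ⌋ * suc p
  ⌊log₂⌋-cross zero      p q = z≤n
  ⌊log₂⌋-cross n@(suc _) p q = ^-cancel-≤ (a * suc q) (suc b * suc p) (begin
    2 ^ (a * suc q)       ≡⟨ sym (^-*-assoc 2 a (suc q)) ⟩
    (2 ^ a) ^ suc q       ≤⟨ ^-monoˡ-≤ (suc q) (2^⌊log₂⌋≤ (n ^ suc p) (m^n>0 n (suc p))) ⟩
    (n ^ suc p) ^ suc q   ≡⟨ ^-*-assoc n (suc p) (suc q) ⟩
    n ^ (suc p * suc q)   ≡⟨ cong (n ^_) (*-comm (suc p) (suc q)) ⟩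
    n ^ (suc q * suc p)   ≡⟨ sym (^-*-assoc n (suc q) (suc p)) ⟩
    (n ^ suc q) ^ suc p   ≤⟨ ^-monoˡ-≤ (suc p) (<⇒≤ (<2^1+⌊log₂⌋ (n ^ suc q))) ⟩
    (2 ^ suc b) ^ suc p   ≡⟨ ^-*-assoc 2 (suc b) (suc p) ⟩
    2 ^ (suc b * suc p)   ∎)
    where open ≤-Reasoning
          a = ⌊log₂ (n ^ suc p) ⌋
          b = ⌊log₂ (n ^ suc q) ⌋

  /-mono-≤ : ∀ a p b q → a * suc q ≤ b * suc p → + a ℚ./ suc p ℚ.≤ + b ℚ./ suc q
  /-mono-≤ a p b q aq≤bp = ℚ.toℚᵘ-cancel-≤
    (ℚᵘ.≤-respˡ-≃ (ℚᵘ.≃-sym (ℚ.toℚᵘ-fromℚᵘ (ℚᵘ.mkℚᵘ (+ a) p)))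
      (ℚᵘ.≤-respʳ-≃ (ℚᵘ.≃-sym (ℚ.toℚᵘ-fromℚᵘ (ℚᵘ.mkℚᵘ (+ b) q)))
        (ℚᵘ.*≤* (subst₂ ℤ._≤_ (ℤ.pos-* a (suc q)) (ℤ.pos-* b (suc p)) (ℤ.+≤+ aq≤bp)))))

  /-suc : ∀ b q → + suc b ℚ./ suc q ≡ + b ℚ./ suc q ℚ.+ + 1 ℚ./ suc q
  /-suc b q = ℚ.toℚᵘ-injective (begin
    ℚ.toℚᵘ (+ suc b ℚ./ suc q)
      ≈⟨ ℚ.toℚᵘ-fromℚᵘ (ℚᵘ.mkℚᵘ (+ suc b) q) ⟩
    ℚᵘ.mkℚᵘ (+ suc b) q
      ≈⟨ ℚᵘ.*≡* integer ⟩
    ℚᵘ.mkℚᵘ (+ b) q ℚᵘ.+ ℚᵘ.mkℚᵘ (+ 1) q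
      ≈⟨ ℚᵘ.+-cong (ℚ.toℚᵘ-fromℚᵘ (ℚᵘ.mkℚᵘ (+ b) q)) (ℚ.toℚᵘ-fromℚᵘ (ℚᵘ.mkℚᵘ (+ 1) q)) ⟨
    ℚ.toℚᵘ (+ b ℚ./ suc q) ℚᵘ.+ ℚ.toℚᵘ (+ 1 ℚ./ suc q)
      ≈⟨ ℚ.toℚᵘ-homo-+ (+ b ℚ./ suc q) (+ 1 ℚ./ suc q) ⟨
    ℚ.toℚᵘ (+ b ℚ./ suc q ℚ.+ + 1 ℚ./ suc q) ∎)
    where open ℚᵘ.≃-Reasoning
          Q = + suc q
          integer : + suc b ℤ.* + (suc q * suc q) ≡ (+ b ℤ.* Q ℤ.+ + 1 ℤ.* Q) ℤ.* Q
          integer = trans (cong (+ suc b ℤ.*_) (ℤ.pos-* (suc q) (suc q)))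
            (solve 2 (λ B X → (con (+ 1) :+ B) :* (X :* X) := (B :* X :+ con (+ 1) :* X) :* X)
              refl (+ b) Q)
            where open ℤ-Solver

  1/≤ : ∀ δ → 0ℚ ℚ.< δ → ∀ {q} → ℚ.denominatorℕ δ ≤ suc q → + 1 ℚ./ suc q ℚ.≤ δ
  1/≤ δ@(ℚ.mkℚ (+ suc a) d _) 0<δ {q} d≤q = subst (+ 1 ℚ./ suc q ℚ.≤_) (ℚ.↥p/↧p≡p δ)
    (/-mono-≤ 1 q (suc a) d (≤-trans (≤-reflexive (*-identityˡ (suc d)))
                                     (≤-trans d≤q (m≤m+n (suc q) (a * suc q)))))
  1/≤ (ℚ.mkℚ (+ zero) d _) (ℚ.*<* (ℤ.+<+ ()))
  1/≤ (ℚ.mkℚ (ℤ.-[1+ a ]) d _) (ℚ.*<* ())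

  ∣-∣≤ : ∀ x y {δ} → x ℚ.≤ y ℚ.+ δ → y ℚ.≤ x ℚ.+ δ → ℚ.∣ x ℚ.- y ∣ ℚ.≤ δ
  ∣-∣≤ x y {δ} x≤ y≤ with ℚ.∣p∣≡p∨∣p∣≡-p (x ℚ.- y)
  ... | inj₁ eq = subst₂ ℚ._≤_ (sym eq)
    (+--cancel y δ) (ℚ.+-monoˡ-≤ (ℚ.- y) x≤)
  ... | inj₂ eq = subst₂ ℚ._≤_
    (trans (neg-diff x y) (sym eq))
    (+--cancel x δ) (ℚ.+-monoˡ-≤ (ℚ.- x) y≤)

open Log-Lemmas

-- With K = suc k,  K log n - 1 < ⌊log₂ (n ^ K)⌋ ≤ K log n  for n ≥ 1, so the
-- k-th approximation is within 1/K of log n.  Convention: log₂ 0 is 0.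

log₂ : ℕ → ℝ
log₂ n .approx k = + ⌊log₂ (n ^ suc k) ⌋ ℚ./ suc k
log₂ n .cauchy δ 0<δ = ℚ.denominatorℕ δ , λ {j} {k} N≤j N≤k →
  ∣-∣≤ (approx (log₂ n) j) (approx (log₂ n) k) (half j k N≤k) (half k j N≤j)
  where
  half : ∀ j k → ℚ.denominatorℕ δ ≤ k → approx (log₂ n) j ℚ.≤ approx (log₂ n) k ℚ.+ δ
  half j k N≤k = begin
    + ⌊log₂ (n ^ suc j) ⌋ ℚ./ suc j
      ≤⟨ /-mono-≤ ⌊log₂ (n ^ suc j) ⌋ j (suc ⌊log₂ (n ^ suc k) ⌋) k (⌊log₂⌋-cross n j k) ⟩
    + suc ⌊log₂ (n ^ suc k) ⌋ ℚ./ suc k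
      ≡⟨ /-suc ⌊log₂ (n ^ suc k) ⌋ k ⟩
    + ⌊log₂ (n ^ suc k) ⌋ ℚ./ suc k ℚ.+ + 1 ℚ./ suc k
      ≤⟨ ℚ.+-monoʳ-≤ (+ ⌊log₂ (n ^ suc k) ⌋ ℚ./ suc k) (1/≤ δ 0<δ (m≤n⇒m≤1+n N≤k)) ⟩
    + ⌊log₂ (n ^ suc k) ⌋ ℚ./ suc k ℚ.+ δ ∎
    where open ℚ.≤-Reasoning

log² : ℕ → ℝ
log² n = log₂ n *ℝ log₂ n

0<log² : ∀ n .{{_ : NonTrivial n}} → 0<ℝ log² n
0<log² n = 1ℚ , ℚ.positive⁻¹ 1ℚ , 0 , λ {k} _ →
  *-mono-≤-nonNeg (ℚ.<⇒≤ (ℚ.positive⁻¹ 1ℚ)) (ℚ.≤-trans (ℚ.<⇒≤ (ℚ.positive⁻¹ 1ℚ)) (1≤log k)) (1≤log k) (1≤log k)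
  where
  1≤log : ∀ k → 1ℚ ℚ.≤ approx (log₂ n) k
  1≤log k = /-mono-≤ 1 0 ⌊log₂ (n ^ suc k) ⌋ k (begin
    1 * suc k                 ≡⟨ *-identityˡ (suc k) ⟩
    suc k                     ≡⟨ sym (⌊log₂[2^n]⌋≡n (suc k)) ⟩
    ⌊log₂ (2 ^ suc k) ⌋       ≤⟨ ⌊log₂⌋-mono-≤ (^-monoˡ-≤ (suc k) (nonTrivial⇒n>1 n)) ⟩
    ⌊log₂ (n ^ suc k) ⌋       ≡⟨ sym (*-identityʳ _) ⟩
    ⌊log₂ (n ^ suc k) ⌋ * 1   ∎)
    where open ≤-Reasoning

infixl 7 _/log²_

_/log²_ : ℝ → (n : ℕ) → .{{NonTrivial n}} → ℝ
x /log² n = x *ℝ 1/ℝ (log² n) (0<log² n)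

record EdgeSet (m : ℕ) : Set where
  field
    adj        : Fin m → Fin m → Bool
    adj-sym    : ∀ u v → adj u v ≡ adj v u
    adj-irrefl : ∀ v → adj v v ≡ false

  Adj : Fin m → Fin m → Set
  Adj u v = T (adj u v)

open EdgeSet using (adj; adj-sym; adj-irrefl; Adj)

infix 4 _⊆ᴱ_

_⊆ᴱ_ : ∀ {m} → EdgeSet m → EdgeSet m → Set
F ⊆ᴱ E = ∀ u v → Adj F u v → Adj E u v

∣_∣ᴱ : ∀ {m} → EdgeSet m → ℕ
∣_∣ᴱ {m} F = length (filter (λ (u , v) → (u Fin.<? v) ×-dec T? (adj F u v))
                            (cartesianProduct (allFin m) (allFin m)))

infixl 6 _∖ᴱ_

_∖ᴱ_ : ∀ {m} → EdgeSet m → EdgeSet m → EdgeSet m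
E ∖ᴱ F = record
  { adj        = λ u v → adj E u v ∧ not (adj F u v)
  ; adj-sym    = λ u v → cong₂ (λ a b → a ∧ not b) (adj-sym E u v) (adj-sym F u v)
  ; adj-irrefl = λ v → cong (_∧ not (adj F v v)) (adj-irrefl E v)
  }

-- The vertex set is a subset of Fin m, so that G and its subgraphs have the
-- same type.

record Graph (m : ℕ) : Set where
  field
    vertices : Subset m
    edges    : EdgeSet m
    incident : ∀ u v → Adj edges u v → u ∈ vertices

open Graph

∣_∣ᴳ : ∀ {m} → Graph m → ℕ
∣ G ∣ᴳ = ∣ vertices G ∣

infixl 6 _-ᴱ_

_-ᴱ_ : ∀ {m} → Graph m → EdgeSet m → Graph m
G -ᴱ F = record
  { vertices = vertices G
  ; edges    = edges G ∖ᴱ F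
  ; incident = λ u v → incident G u v ∘ proj₁ ∘ Equivalence.to T-∧
  }

infix 4 _⊆ᴳ_

_⊆ᴳ_ : ∀ {m} → Graph m → Graph m → Set
H ⊆ᴳ G = vertices H ⊆ vertices G × edges H ⊆ᴱ edges G

N : ∀ {m} → Graph m → Subset m → Subset m
N G U = tabulate λ v → does
  ((v ∈? vertices G) ×-dec ¬? (v ∈? U) ×-dec Fin.any? λ u → (u ∈? U) ×-dec T? (adj (edges G) u v))

bounds⇒nonTrivial : ∀ {u n} → 1 ≤ u → 3 * u ≤ 2 * n → NonTrivial n
bounds⇒nonTrivial {n = 0} (s≤s z≤n) ()
bounds⇒nonTrivial {n = 1} 1≤u 3u≤2 = contradiction (≤-trans (*-monoʳ-≤ 3 1≤u) 3u≤2) λ { (s≤s (s≤s ())) }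
bounds⇒nonTrivial {n = suc (suc n)} _ _ = _

IsExpander : ∀ {m} → ℝ → ℕ → Graph m → Set
IsExpander ε s G = ∀ U F → U ⊆ vertices G → F ⊆ᴱ edges G →
  (1≤∣U∣ : 1 ≤ ∣ U ∣) (∣U∣≤⅔n : 3 * ∣ U ∣ ≤ 2 * n) → ∣ F ∣ᴱ ≤ s * ∣ U ∣ →
  let instance _ = bounds⇒nonTrivial 1≤∣U∣ ∣U∣≤⅔n in
  ε *ℝ fromℕ ∣ U ∣ /log² n ≤ℝ fromℕ ∣ N (G -ᴱ F) U ∣
  where n = ∣ G ∣ᴳ

-- Every edge lies in exactly one part; parts may share vertices.

IsEdgePartition : ∀ {m r} → Graph m → Vector (Graph m) r → Set
IsEdgePartition G H =
  (∀ i → H i ⊆ᴳ G) ×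
  (∀ u v → Adj (edges G) u v → ∃! _≡_ λ i → Adj (edges (H i)) u v)

-- If G is not an expander, some U expands badly after few edges are removed.
-- Taking X for the remaining neighbourhood of U, delete the edges leaving
-- U ∪ X from U and recurse on the edges meeting U and on those avoiding U.
-- With Λ(n) = ⌊log₂ n⌋, two potentials on the orders u + x and n - u of the
-- pieces control the recursion:
--   Σ_{k ≤ n} Λ(k)  for the deletions,  Σ_{k ≤ n} (2 - 1/(Λ(k)+1))  for the orders.
-- For b ≥ k we have Λ(b + k) > Λ(k), so each potential drops by a multiple of
-- min(u, n - u) ≥ u/2 when n is split as u + (n - u); this pays for the at most
-- s u deleted edges and for the x < u/(32 Λ(n)²) repeated vertices.

module Submission where

open import Data.Bool using (false; true; _∧_; _∨_; not; T)
open import Data.Bool.Properties using (T?; T-∧; T-∨)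
open import Data.Fin using (Fin; zero; suc; splitAt; join)
import Data.Fin.Properties as Fin
open import Data.Fin.Subset using (Subset; _∈_; _∉_; _⊆_; ∣_∣; _∪_; _∩_; _─_; inside; outside)
open import Data.Fin.Subset.Properties
open import Data.Integer as ℤ using (+_)
import Data.Integer.Properties as ℤ
open import Data.List using ([]; _∷_; length; filter; allFin; cartesianProduct)
open import Data.List.Properties using (filter-none)
import Data.List.Relation.Unary.All as All
open import Data.Nat as ℕ hiding (_/_)
open import Data.Nat.Divisibility using (_∣_; ∣-trans; m∣m*n; m≤n⇒m!∣n!)
open import Data.Nat.DivMod using (m/n*n≡m; m/n≤m; /-monoʳ-≤)
open import Data.Nat.Induction using (Acc; acc; <-wellFounded)
open import Data.Nat.Logarithm using (⌊log₂_⌋; ⌊log₂⌋-mono-≤; ⌊log₂[2^n]⌋≡n; ⌊log₂[2*b]⌋≡1+⌊log₂b⌋)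
open import Data.Nat.Properties
open import Data.Nat.Solver using (module +-*-Solver)
open import Data.Product using (_×_; _,_; proj₁; proj₂; ∃-syntax; Σ-syntax; ∃!; map₂; swap)
open import Data.Rational as ℚ using (ℚ; 0ℚ; 1ℚ; _/_)
import Data.Rational.Properties as ℚ
import Data.Rational.Unnormalised as ℚᵘ
import Data.Rational.Unnormalised.Properties as ℚᵘ
open import Data.Sum as Sum using (_⊎_; inj₁; inj₂; [_,_]′)
open import Data.Unit using (tt)
open import Data.Vec as Vec using ([]; _∷_)
open import Data.Vec.Functional using (Vector)
open import Data.Vec.Properties using (lookup∘tabulate; lookup⇒[]=)
open import Algebra.Properties.CommutativeMonoid.Sum +-0-commutativeMonoid using (sum; sum-cong-≗)
open import Function using (_∘_; Equivalence; mk⇔)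
open import Relation.Binary using (Decidable; Symmetric)
open import Relation.Binary.PropositionalEquality
open import Relation.Nullary using (Dec; does; yes; no; ¬_; ¬?; _×-dec_; _⊎-dec_; contradiction)
open import Relation.Nullary.Decidable using (does-⇔; dec-true)
open import Defs
open EdgeSet using (adj; adj-sym; adj-irrefl; Adj)
open Graph

-- Summed weights and their drop when an order is split.

module LogTotals where

  open ≤-Reasoning

  total : (ℕ → ℕ) → ℕ → ℕ
  total w zero    = 0
  total w (suc n) = total w n + w (suc n)

  module _ {w : ℕ → ℕ} where

    total-mono-≤ : ∀ {m n} → m ≤ n → total w m ≤ total w n
    total-mono-≤ {m} m≤n = go (≤⇒≤′ m≤n)
      where
      go : ∀ {n} → m ≤′ n → total w m ≤ total w n
      go (≤′-reflexive refl) = ≤-refl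
      go (≤′-step {n} m≤′n)  = ≤-trans (go m≤′n) (m≤m+n (total w n) (w (suc n)))

    total-≥ : ∀ {c} n → (∀ k → c ≤ w k) → n * c ≤ total w n
    total-≥ {c} zero    c≤w = z≤n
    total-≥ {c} (suc n) c≤w = begin
      c + n * c              ≡⟨ +-comm c (n * c) ⟩
      n * c + c              ≤⟨ +-mono-≤ (total-≥ n c≤w) (c≤w (suc n)) ⟩
      total w n + w (suc n)  ∎

    total-+-≤ : ∀ {B} a x → (∀ {k} → k ≤ a + x → w k ≤ B) → total w (a + x) ≤ total w a + x * B
    total-+-≤ {B} a zero    w≤B = ≤-reflexive (trans (cong (total w) (+-identityʳ a)) (sym (+-identityʳ (total w a))))
    total-+-≤ {B} a (suc x) w≤B = begin
      total w (a + suc x)              ≡⟨ cong (total w) (+-suc a x) ⟩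
      total w (a + x) + w (suc (a + x))
        ≤⟨ +-mono-≤ (total-+-≤ a x (λ k≤ → w≤B (≤-trans k≤ (+-monoʳ-≤ a (n≤1+n x)))))
                    (w≤B (≤-reflexive (sym (+-suc a x)))) ⟩
      total w a + x * B + B            ≡⟨ solve 3 (λ t y b → t :+ y :+ b := t :+ (b :+ y)) refl (total w a) (x * B) B ⟩
      total w a + suc x * B            ∎
      where open +-*-Solver

    -- The last `a` terms of `total w (b + a)` are compared with the terms of `total w a` one by
    -- one: position `b + k` beats position `k` by `c / K`. The factor `K` keeps fractional gains
    -- inside the naturals.
    total-superadditive : ∀ {K c} a b → (∀ {k} → 1 ≤ k → k ≤ a → K * w k + c ≤ K * w (b + k)) →
                          K * total w a + K * total w b + a * c ≤ K * total w (b + a)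
    total-superadditive {K} {c} zero    b gap = begin
      K * 0 + K * total w b + 0  ≡⟨ solve 2 (λ k t → k :* con 0 :+ k :* t :+ con 0 := k :* t) refl K (total w b) ⟩
      K * total w b              ≡⟨ cong (λ n → K * total w n) (+-identityʳ b) ⟨
      K * total w (b + 0)        ∎
      where open +-*-Solver
    total-superadditive {K} {c} (suc a) b gap = begin
      K * (total w a + w (suc a)) + K * total w b + (c + a * c)
        ≡⟨ solve 6 (λ k t v s d e → k :* (t :+ v) :+ k :* s :+ (d :+ e) := (k :* t :+ k :* s :+ e) :+ (k :* v :+ d))
             refl K (total w a) (w (suc a)) (total w b) c (a * c) ⟩
      (K * total w a + K * total w b + a * c) + (K * w (suc a) + c)
        ≤⟨ +-mono-≤ (total-superadditive {K} {c} a b (λ 1≤k k≤a → gap 1≤k (m≤n⇒m≤1+n k≤a))) (gap (s≤s z≤n) ≤-refl) ⟩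
      K * total w (b + a) + K * w (b + suc a)
        ≡⟨ cong (λ n → K * total w (b + a) + K * w n) (+-suc b a) ⟩
      K * total w (b + a) + K * w (suc (b + a))
        ≡⟨ *-distribˡ-+ K (total w (b + a)) (w (suc (b + a))) ⟨
      K * total w (suc (b + a))
        ≡⟨ cong (λ n → K * total w n) (+-suc b a) ⟨
      K * total w (b + suc a) ∎
      where open +-*-Solver

    -- The smaller of `u` and `v` is stacked on top of the larger in `total-superadditive`, so the
    -- gap is needed only for `j ≤ k`, and the gain is `c / K` for each of `u ⊓ v` terms. The `x`
    -- repeated vertices cost at most `B` each.
    total-split : ∀ {K c B} u v x → u + x ≤ u + v →
                  (∀ {j k} → 1 ≤ j → j ≤ k → k + j ≤ u + v → K * w j + c ≤ K * w (k + j)) →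
                  (∀ {k} → k ≤ u + v → w k ≤ B) →
                  K * (total w (u + x) + total w v) + (u ⊓ v) * c ≤ K * (total w (u + v) + x * B)
    total-split {K} {c} {B} u v x u+x≤ gap w≤B = begin
      K * (total w (u + x) + total w v) + (u ⊓ v) * c
        ≤⟨ +-monoˡ-≤ _ (*-monoʳ-≤ K (+-monoˡ-≤ (total w v) (total-+-≤ u x (λ k≤ → w≤B (≤-trans k≤ u+x≤))))) ⟩
      K * (total w u + x * B + total w v) + (u ⊓ v) * c
        ≡⟨ solve 5 (λ k t y s e → k :* (t :+ y :+ s) :+ e := (k :* t :+ k :* s :+ e) :+ k :* y)
             refl K (total w u) (x * B) (total w v) ((u ⊓ v) * c) ⟩
      (K * total w u + K * total w v + (u ⊓ v) * c) + K * (x * B)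
        ≤⟨ +-monoˡ-≤ (K * (x * B)) superadditive ⟩
      K * total w (u + v) + K * (x * B)
        ≡⟨ *-distribˡ-+ K (total w (u + v)) (x * B) ⟨
      K * (total w (u + v) + x * B) ∎
      where
      open +-*-Solver
      superadditive : K * total w u + K * total w v + (u ⊓ v) * c ≤ K * total w (u + v)
      superadditive with ≤-total u v
      ... | inj₁ u≤v rewrite m≤n⇒m⊓n≡m u≤v | +-comm u v =
        total-superadditive {K} {c} u v λ 1≤k k≤u → gap 1≤k (≤-trans k≤u u≤v) (+-monoʳ-≤ v k≤u)
      ... | inj₂ v≤u rewrite m≥n⇒m⊓n≡n v≤u | +-comm (K * total w u) (K * total w v) =
        total-superadditive {K} {c} v u λ 1≤k k≤v → gap 1≤k (≤-trans k≤v v≤u) (+-monoʳ-≤ u k≤v)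

  ⌊log₂⌋-double : ∀ {j k} → 1 ≤ j → j ≤ k → ⌊log₂ j ⌋ < ⌊log₂ (k + j) ⌋
  ⌊log₂⌋-double {j@(suc _)} {k} _ j≤k = begin
    suc ⌊log₂ j ⌋     ≡⟨ ⌊log₂[2*b]⌋≡1+⌊log₂b⌋ j ⟨
    ⌊log₂ (2 * j) ⌋   ≡⟨ cong (λ i → ⌊log₂ (j + i) ⌋) (+-identityʳ j) ⟩
    ⌊log₂ (j + j) ⌋   ≤⟨ ⌊log₂⌋-mono-≤ (+-monoˡ-≤ j j≤k) ⟩
    ⌊log₂ (k + j) ⌋   ∎

  logTotal : ℕ → ℕ
  logTotal = total ⌊log₂_⌋

  logTotal≤ : ∀ n → logTotal n ≤ n * ⌊log₂ n ⌋
  logTotal≤ n = total-+-≤ 0 n ⌊log₂⌋-mono-≤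

  -- M times 2 - 1/(Λ(k)+1); the division is exact in the range used, where M
  -- is a multiple of all 1 ≤ l ≤ Λ(n)+1.
  orderWeight : ℕ → ℕ → ℕ
  orderWeight M k = 2 * M ∸ M ℕ./ suc ⌊log₂ k ⌋

  orderTotal : ℕ → ℕ → ℕ
  orderTotal M = total (orderWeight M)

  orderTotal≤ : ∀ M n → orderTotal M n ≤ n * (2 * M)
  orderTotal≤ M n = total-+-≤ 0 n (λ {k} _ → m∸n≤m (2 * M) (M ℕ./ suc ⌊log₂ k ⌋))

  -- Each weight is at least `M` because the reciprocal subtracted is at most one. This is the base
  -- case of the recursion, where a graph of order `n` is kept as a single part.
  orderTotal≥ : ∀ M n → n * M ≤ orderTotal M n
  orderTotal≥ M n = total-≥ n λ k → begin
    M                            ≡⟨ m+n∸n≡m M M ⟨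
    M + M ∸ M                    ≡⟨ cong (λ z → M + z ∸ M) (+-identityʳ M) ⟨
    2 * M ∸ M                    ≤⟨ ∸-monoʳ-≤ (2 * M) (m/n≤m M (suc ⌊log₂ k ⌋)) ⟩
    2 * M ∸ M ℕ./ suc ⌊log₂ k ⌋    ∎

  -- This is 1/l - 1/(l+1) = 1/(l(l+1)), scaled by `K * M`. Divisibility makes both quotients exact;
  -- the excess `e` of `K` over l(l+1) only needs division to be antitone in the divisor.
  reciprocal-gap : ∀ {M K} l .{{_ : NonZero l}} → l ∣ M → suc l ∣ M → l * suc l ≤ K →
                   K * (M ℕ./ suc l) + M ≤ K * (M ℕ./ l)
  reciprocal-gap {M} l l∣M 1+l∣M K≥ with m≤n⇒∃[o]m+o≡n K≥
  ... | e , refl = begin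
    (l * suc l + e) * q₁ + M
      ≡⟨ solve 4 (λ l e q m → (l :* (con 1 :+ l) :+ e) :* q :+ m := l :* (q :* (con 1 :+ l)) :+ m :+ e :* q) refl l e q₁ M ⟩
    l * (q₁ * suc l) + M + e * q₁
      ≡⟨ cong (λ z → l * z + M + e * q₁) (trans (m/n*n≡m 1+l∣M) (sym (m/n*n≡m l∣M))) ⟩
    l * (q₀ * l) + M + e * q₁
      ≡⟨ cong (λ z → l * (q₀ * l) + z + e * q₁) (sym (m/n*n≡m l∣M)) ⟩
    l * (q₀ * l) + q₀ * l + e * q₁
      ≤⟨ +-monoʳ-≤ (l * (q₀ * l) + q₀ * l) (*-monoʳ-≤ e (/-monoʳ-≤ M (n≤1+n l))) ⟩
    l * (q₀ * l) + q₀ * l + e * q₀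
      ≡⟨ solve 3 (λ l e q → l :* (q :* l) :+ q :* l :+ e :* q := (l :* (con 1 :+ l) :+ e) :* q) refl l e q₀ ⟩
    (l * suc l + e) * q₀ ∎
    where
    open +-*-Solver
    q₀ = M ℕ./ l
    q₁ = M ℕ./ suc l

  orderWeight-+ : ∀ M k → orderWeight M k + M ℕ./ suc ⌊log₂ k ⌋ ≡ 2 * M
  orderWeight-+ M k = m∸n+n≡m (≤-trans (m/n≤m M (suc ⌊log₂ k ⌋)) (m≤n*m M 2))

  -- With `l` the logarithm of `k + j`, doubling gives Λ(j) + 1 ≤ l, so the subtracted reciprocal
  -- falls from at least 1/l to 1/(l+1). The factor 2Λ² bounds l(l+1) because 1 ≤ l ≤ Λ.
  orderWeight-gap : ∀ {M n j k} → (∀ {l} → 1 ≤ l → l ≤ suc ⌊log₂ n ⌋ → l ∣ M) →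
                    1 ≤ j → j ≤ k → k + j ≤ n →
                    2 * (⌊log₂ n ⌋ * ⌊log₂ n ⌋) * orderWeight M j + M ≤ 2 * (⌊log₂ n ⌋ * ⌊log₂ n ⌋) * orderWeight M (k + j)
  -- Adding the subtracted quotient to both sides avoids truncated subtraction: a weight plus its
  -- own quotient is exactly `2 * M`.
  orderWeight-gap {M} {n} {j} {k} ∣M 1≤j j≤k k+j≤n = +-cancelʳ-≤ (K * (M ℕ./ suc l)) _ _ (begin
    K * orderWeight M j + M + K * (M ℕ./ suc l)      ≡⟨ +-assoc (K * orderWeight M j) M _ ⟩
    K * orderWeight M j + (M + K * (M ℕ./ suc l))    ≡⟨ cong (_+_ (K * orderWeight M j)) (+-comm M _) ⟩
    K * orderWeight M j + (K * (M ℕ./ suc l) + M)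
      -- Both `l` and `suc l` must divide `M`; as `l` may equal Λ, divisibility is required up to
      -- `suc Λ`.
      ≤⟨ +-monoʳ-≤ (K * orderWeight M j)
           (reciprocal-gap l (∣M 1≤l (m≤n⇒m≤1+n l≤Λ)) (∣M (s≤s z≤n) (s≤s l≤Λ)) l[1+l]≤K) ⟩
    K * orderWeight M j + K * (M ℕ./ l)              ≤⟨ +-monoʳ-≤ (K * orderWeight M j) (*-monoʳ-≤ K (/-monoʳ-≤ M j<l)) ⟩
    K * orderWeight M j + K * (M ℕ./ suc ⌊log₂ j ⌋)  ≡⟨ *-distribˡ-+ K (orderWeight M j) _ ⟨
    K * (orderWeight M j + M ℕ./ suc ⌊log₂ j ⌋)    
      ≡⟨ cong (K *_) (trans (orderWeight-+ M j) (sym (orderWeight-+ M (k + j)))) ⟩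
    K * (orderWeight M (k + j) + M ℕ./ suc l)        ≡⟨ *-distribˡ-+ K (orderWeight M (k + j)) _ ⟩
    K * orderWeight M (k + j) + K * (M ℕ./ suc l)    ∎)
    where
    Λ = ⌊log₂ n ⌋
    l = ⌊log₂ (k + j) ⌋
    K = 2 * (Λ * Λ)
    j<l : ⌊log₂ j ⌋ < l
    j<l = ⌊log₂⌋-double 1≤j j≤k
    1≤l : 1 ≤ l
    1≤l = ≤-trans (s≤s z≤n) j<l
    l≤Λ : l ≤ Λ
    l≤Λ = ⌊log₂⌋-mono-≤ k+j≤n
    instance _ = >-nonZero 1≤l
    l[1+l]≤K : l * suc l ≤ K
    l[1+l]≤K = begin
      l * suc l        ≤⟨ *-monoʳ-≤ l (+-monoˡ-≤ l 1≤l) ⟩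
      l * (l + l)      ≤⟨ *-mono-≤ l≤Λ (+-mono-≤ l≤Λ l≤Λ) ⟩
      Λ * (Λ + Λ)      ≡⟨ solve 1 (λ a → a :* (a :+ a) := con 2 :* (a :* a)) refl Λ ⟩
      2 * (Λ * Λ)      ∎
      where open +-*-Solver

  -- Numerical consequences of bad expansion, with `v` the order left outside `U`.

  module _ {u v x : ℕ} (3u≤2n : 3 * u ≤ 2 * (u + v)) (1≤Λ : 1 ≤ ⌊log₂ (u + v) ⌋)
           (sparse : 32 * (x * (⌊log₂ (u + v) ⌋ * ⌊log₂ (u + v) ⌋)) < u) where

    private
      n = u + v
      Λ = ⌊log₂ n ⌋

      u≤2v : u ≤ 2 * v
      u≤2v = +-cancelˡ-≤ (2 * u) u (2 * v) (begin
        2 * u + u      ≡⟨ solve 1 (λ u → con 2 :* u :+ u := con 3 :* u) refl u ⟩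
        3 * u          ≤⟨ 3u≤2n ⟩
        2 * (u + v)    ≡⟨ *-distribˡ-+ 2 u v ⟩
        2 * u + 2 * v  ∎)
        where open +-*-Solver

      u≤2[u⊓v] : u ≤ 2 * (u ⊓ v)
      u≤2[u⊓v] = begin
        u                    ≤⟨ ⊓-glb (m≤n*m u 2) u≤2v ⟩
        (2 * u) ⊓ (2 * v)    ≡⟨ *-distribˡ-⊓ 2 u v ⟨
        2 * (u ⊓ v)          ∎

      x≤xΛ : x ≤ x * Λ
      x≤xΛ = begin
        x      ≡⟨ *-identityʳ x ⟨
        x * 1  ≤⟨ *-monoʳ-≤ x 1≤Λ ⟩
        x * Λ  ∎

      xΛ≤xΛΛ : x * Λ ≤ x * (Λ * Λ)
      xΛ≤xΛΛ = begin
        x * Λ        ≡⟨ cong (x *_) (*-identityʳ Λ) ⟨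
        x * (Λ * 1)  ≤⟨ *-monoʳ-≤ x (*-monoʳ-≤ Λ 1≤Λ) ⟩
        x * (Λ * Λ)  ∎

    -- Sparsity gives 2x < u, and u ≤ 2v follows from 3u ≤ 2(u + v). Besides making the recursion
    -- terminate, this keeps the weights of the near piece within the bound for `n`.
    split-< : u + x < u + v
    split-< = +-monoʳ-< u (*-cancelˡ-< 2 x v (begin-strict
      2 * x                ≤⟨ *-monoʳ-≤ 2 (≤-trans x≤xΛ xΛ≤xΛΛ) ⟩
      2 * (x * (Λ * Λ))    ≤⟨ *-monoˡ-≤ (x * (Λ * Λ)) {2} {32} (s≤s (s≤s z≤n)) ⟩
      32 * (x * (Λ * Λ))   <⟨ sparse ⟩
      u                    ≤⟨ u≤2v ⟩
      2 * v                ∎))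

    -- The drop is at least `u ⊓ v`, hence 4 times it is at least 2u. One `u` remains to pay for the
    -- deletions, the other absorbs the cost 4xΛ of the repeated vertices; this is the source of the
    -- 4 in the edge bound.
    logTotal-split : u + 4 * (logTotal (u + x) + logTotal v) ≤ 4 * logTotal n
    logTotal-split = +-cancelʳ-≤ (4 * (x * Λ)) _ _ (begin
      u + 4 * t + 4 * (x * Λ)     ≡⟨ solve 3 (λ u t y → u :+ t :+ y := t :+ (u :+ y)) refl u (4 * t) (4 * (x * Λ)) ⟩
      4 * t + (u + 4 * (x * Λ))   ≤⟨ +-monoʳ-≤ (4 * t) (+-monoʳ-≤ u 4xΛ≤u) ⟩
      4 * t + (u + u)             ≤⟨ +-monoʳ-≤ (4 * t) (+-mono-≤ u≤2[u⊓v] u≤2[u⊓v]) ⟩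
      4 * t + (2 * a + 2 * a)
        ≡⟨ solve 2 (λ t a → con 4 :* t :+ (con 2 :* a :+ con 2 :* a) := con 4 :* (con 1 :* t :+ a :* con 1))
             refl t a ⟩
      4 * (1 * t + a * 1)         ≤⟨ *-monoʳ-≤ 4 (total-split {K = 1} {c = 1} u v x (<⇒≤ split-<) gap ⌊log₂⌋-mono-≤) ⟩
      4 * (1 * (logTotal n + x * Λ))
        ≡⟨ solve 2 (λ t y → con 4 :* (con 1 :* (t :+ y)) := con 4 :* t :+ con 4 :* y) refl (logTotal n) (x * Λ) ⟩
      4 * logTotal n + 4 * (x * Λ) ∎)
      where
      open +-*-Solver
      t = logTotal (u + x) + logTotal v
      a = u ⊓ v
      4xΛ≤u : 4 * (x * Λ) ≤ u
      4xΛ≤u = begin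
        4 * (x * Λ)          ≤⟨ *-mono-≤ {4} {32} (s≤s (s≤s (s≤s (s≤s z≤n)))) xΛ≤xΛΛ ⟩
        32 * (x * (Λ * Λ))   ≤⟨ <⇒≤ sparse ⟩
        u                    ∎
      gap : ∀ {j k} → 1 ≤ j → j ≤ k → k + j ≤ n → 1 * ⌊log₂ j ⌋ + 1 ≤ 1 * ⌊log₂ (k + j) ⌋
      gap {j} {k} 1≤j j≤k _ = begin
        1 * ⌊log₂ j ⌋ + 1   ≡⟨ solve 1 (λ a → con 1 :* a :+ con 1 := con 1 :+ a) refl ⌊log₂ j ⌋ ⟩
        suc ⌊log₂ j ⌋       ≤⟨ ⌊log₂⌋-double 1≤j j≤k ⟩
        ⌊log₂ (k + j) ⌋     ≡⟨ *-identityˡ _ ⟨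
        1 * ⌊log₂ (k + j) ⌋ ∎

    -- After scaling by `K`, the gain is `(u ⊓ v) * M` and the repeated vertices, each of weight at
    -- most `2 * M`, cost 4xΛ²M. Sparsity bounds 8xΛ² by u ≤ 2(u ⊓ v), so the gain covers the cost.
    orderTotal-split : ∀ {M} → (∀ {l} → 1 ≤ l → l ≤ suc Λ → l ∣ M) →
                       orderTotal M (u + x) + orderTotal M v ≤ orderTotal M n
    orderTotal-split {M} ∣M = *-cancelˡ-≤ K (+-cancelʳ-≤ ((u ⊓ v) * M) _ _ (begin
      K * (orderTotal M (u + x) + orderTotal M v) + (u ⊓ v) * M
        ≤⟨ total-split {K = K} {c = M} u v x (<⇒≤ split-<) (orderWeight-gap ∣M)
             (λ {k} _ → m∸n≤m (2 * M) (M ℕ./ suc ⌊log₂ k ⌋)) ⟩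
      K * (orderTotal M n + x * (2 * M))
        ≡⟨ solve 4 (λ l t x m → con 2 :* (l :* l) :* (t :+ x :* (con 2 :* m))
                               := con 2 :* (l :* l) :* t :+ con 4 :* (x :* (l :* l)) :* m)
             refl Λ (orderTotal M n) x M ⟩
      K * orderTotal M n + 4 * (x * (Λ * Λ)) * M
        ≤⟨ +-monoʳ-≤ (K * orderTotal M n) (*-monoˡ-≤ M 4xΛΛ≤u⊓v) ⟩
      K * orderTotal M n + (u ⊓ v) * M ∎))
      where
      open +-*-Solver
      K = 2 * (Λ * Λ)
      instance
        _ = >-nonZero 1≤Λ
        _ = m*n≢0 Λ Λ
        _ = m*n≢0 2 (Λ * Λ)
      4xΛΛ≤u⊓v : 4 * (x * (Λ * Λ)) ≤ u ⊓ v
      4xΛΛ≤u⊓v = *-cancelˡ-≤ 2 (begin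
        2 * (4 * (x * (Λ * Λ)))  ≡⟨ *-assoc 2 4 (x * (Λ * Λ)) ⟨
        8 * (x * (Λ * Λ))        ≤⟨ *-monoˡ-≤ (x * (Λ * Λ)) {8} {32} (m≤m+n 8 24) ⟩
        32 * (x * (Λ * Λ))       ≤⟨ <⇒≤ sparse ⟩
        u                        ≤⟨ u≤2[u⊓v] ⟩
        2 * (u ⊓ v)              ∎)

  ∣-! : ∀ {l n} → 1 ≤ l → l ≤ n → l ∣ n !
  ∣-! {suc l} _ l≤n = ∣-trans (m∣m*n (l !)) (m≤n⇒m!∣n! l≤n)

open LogTotals

-- Passing from integer logarithms to inequalities between reals.

module RealBounds where

  open ℝ
  open ℚ-Lemmas
  open Log-Lemmas

  ℕ⇒ℚ : ℕ → ℚ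
  ℕ⇒ℚ n = + n ℚ./ 1

  ℕ⇒ℚ-mono-≤ : ∀ {a b} → a ≤ b → ℕ⇒ℚ a ℚ.≤ ℕ⇒ℚ b
  ℕ⇒ℚ-mono-≤ {a} {b} a≤b = /-mono-≤ a 0 b 0 (*-monoˡ-≤ 1 a≤b)

  0≤ℕ⇒ℚ : ∀ n → 0ℚ ℚ.≤ ℕ⇒ℚ n
  0≤ℕ⇒ℚ n = ℕ⇒ℚ-mono-≤ {0} {n} z≤n

  ℕ⇒ℚ-* : ∀ a b → ℕ⇒ℚ (a * b) ≡ ℕ⇒ℚ a ℚ.* ℕ⇒ℚ b
  ℕ⇒ℚ-* a b = ℚ.toℚᵘ-injective (begin
    ℚ.toℚᵘ (ℕ⇒ℚ (a * b))
      ≈⟨ ℚ.toℚᵘ-fromℚᵘ (ℚᵘ.mkℚᵘ (+ (a * b)) 0) ⟩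
    ℚᵘ.mkℚᵘ (+ (a * b)) 0
      ≈⟨ ℚᵘ.*≡* (cong (ℤ._* + 1) (ℤ.pos-* a b)) ⟩
    ℚᵘ.mkℚᵘ (+ a) 0 ℚᵘ.* ℚᵘ.mkℚᵘ (+ b) 0
      ≈⟨ ℚᵘ.*-cong (ℚ.toℚᵘ-fromℚᵘ (ℚᵘ.mkℚᵘ (+ a) 0)) (ℚ.toℚᵘ-fromℚᵘ (ℚᵘ.mkℚᵘ (+ b) 0)) ⟨
    ℚ.toℚᵘ (ℕ⇒ℚ a) ℚᵘ.* ℚ.toℚᵘ (ℕ⇒ℚ b)
      ≈⟨ ℚ.toℚᵘ-homo-* (ℕ⇒ℚ a) (ℕ⇒ℚ b) ⟨
    ℚ.toℚᵘ (ℕ⇒ℚ a ℚ.* ℕ⇒ℚ b) ∎)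
    where open ℚᵘ.≃-Reasoning

  ⌊log₂⌋≤log₂ : ∀ n k → ℕ⇒ℚ ⌊log₂ n ⌋ ℚ.≤ approx (log₂ n) k
  ⌊log₂⌋≤log₂ zero    k = /-mono-≤ 0 0 0 k z≤n
  ⌊log₂⌋≤log₂ n@(suc _) k = /-mono-≤ ⌊log₂ n ⌋ 0 ⌊log₂ (n ^ suc k) ⌋ k (begin
    ⌊log₂ n ⌋ * suc k                 ≡⟨ ⌊log₂[2^n]⌋≡n (⌊log₂ n ⌋ * suc k) ⟨
    ⌊log₂ (2 ^ (⌊log₂ n ⌋ * suc k)) ⌋ ≡⟨ cong ⌊log₂_⌋ (^-*-assoc 2 ⌊log₂ n ⌋ (suc k)) ⟨
    ⌊log₂ ((2 ^ ⌊log₂ n ⌋) ^ suc k) ⌋ ≤⟨ ⌊log₂⌋-mono-≤ (^-monoˡ-≤ (suc k) (2^⌊log₂⌋≤ n (s≤s z≤n))) ⟩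
    ⌊log₂ (n ^ suc k) ⌋               ≡⟨ *-identityʳ _ ⟨
    ⌊log₂ (n ^ suc k) ⌋ * 1           ∎)
    where open ≤-Reasoning

  ≤-+δ : ∀ {p q δ} → 0ℚ ℚ.< δ → p ℚ.≤ q → p ℚ.≤ q ℚ.+ δ
  ≤-+δ {p} {q} 0<δ p≤q = subst (ℚ._≤ _) (ℚ.+-identityʳ p) (ℚ.+-mono-≤ p≤q (ℚ.<⇒≤ 0<δ))

  deletion-bound : ∀ {d} a n → d ≤ a * ⌊log₂ n ⌋ → fromℕ d ≤ℝ fromℕ a *ℝ log₂ n
  deletion-bound {d} a n d≤ δ 0<δ = 0 , λ {k} _ → ≤-+δ 0<δ (begin
    ℕ⇒ℚ d                           ≤⟨ ℕ⇒ℚ-mono-≤ d≤ ⟩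
    ℕ⇒ℚ (a * ⌊log₂ n ⌋)             ≡⟨ ℕ⇒ℚ-* a ⌊log₂ n ⌋ ⟩
    ℕ⇒ℚ a ℚ.* ℕ⇒ℚ ⌊log₂ n ⌋         ≤⟨ ℚ.*-monoˡ-≤-nonNeg (ℕ⇒ℚ a) {{ℚ.nonNegative (0≤ℕ⇒ℚ a)}} (⌊log₂⌋≤log₂ n k) ⟩
    ℕ⇒ℚ a ℚ.* approx (log₂ n) k     ∎)
    where open ℚ.≤-Reasoning


  sparse-ratio : ∀ {c u x y} K → 0ℚ ℚ.≤ c → c ℚ.* ℕ⇒ℚ K ≡ 1ℚ → u ≤ K * (x * y) → c ℚ.* ℕ⇒ℚ u ℚ.≤ ℕ⇒ℚ x ℚ.* ℕ⇒ℚ y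
  sparse-ratio {c} {u} {x} {y} K 0≤c cK≡1 u≤ = begin
    c ℚ.* ℕ⇒ℚ u                        ≤⟨ ℚ.*-monoˡ-≤-nonNeg c {{ℚ.nonNegative 0≤c}} (ℕ⇒ℚ-mono-≤ u≤) ⟩
    c ℚ.* ℕ⇒ℚ (K * (x * y))            ≡⟨ cong (c ℚ.*_) (ℕ⇒ℚ-* K (x * y)) ⟩
    c ℚ.* (ℕ⇒ℚ K ℚ.* ℕ⇒ℚ (x * y))      ≡⟨ ℚ.*-assoc c (ℕ⇒ℚ K) (ℕ⇒ℚ (x * y)) ⟨
    c ℚ.* ℕ⇒ℚ K ℚ.* ℕ⇒ℚ (x * y)        ≡⟨ cong (ℚ._* ℕ⇒ℚ (x * y)) cK≡1 ⟩
    1ℚ ℚ.* ℕ⇒ℚ (x * y)                 ≡⟨ ℚ.*-identityˡ _ ⟩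
    ℕ⇒ℚ (x * y)                        ≡⟨ ℕ⇒ℚ-* x y ⟩
    ℕ⇒ℚ x ℚ.* ℕ⇒ℚ y                    ∎
    where open ℚ.≤-Reasoning

  *-1/-≤ : ∀ {p q} t .{{_ : ℚ.NonZero t}} → 0ℚ ℚ.< t → p ℚ.≤ q ℚ.* t → p ℚ.* ℚ.1/ t ℚ.≤ q
  *-1/-≤ {p} {q} t 0<t p≤qt = begin
    p ℚ.* ℚ.1/ t             ≤⟨ ℚ.*-monoʳ-≤-nonNeg (ℚ.1/ t) {{0≤1/t}} p≤qt ⟩
    q ℚ.* t ℚ.* ℚ.1/ t       ≡⟨ ℚ.*-assoc q t (ℚ.1/ t) ⟩
    q ℚ.* (t ℚ.* ℚ.1/ t)     ≡⟨ cong (q ℚ.*_) (ℚ.*-inverseʳ t) ⟩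
    q ℚ.* 1ℚ                 ≡⟨ ℚ.*-identityʳ q ⟩
    q                        ∎
    where
    open ℚ.≤-Reasoning
    0≤1/t : ℚ.NonNegative (ℚ.1/ t)
    0≤1/t = ℚ.pos⇒nonNeg ((ℚ.1/ t) {{ℚ.pos⇒nonZero t {{pos 0<t}}}}) {{ℚ.1/pos⇒pos t {{pos 0<t}}}}

  -- The error `U * η = δ` is charged to `δ * t`, which is large enough because `t` is at least one.
  ≤-slack : ∀ {e c η U δ X s t} → 0ℚ ℚ.≤ U → 0ℚ ℚ.≤ X → 0ℚ ℚ.≤ δ → e ℚ.≤ c ℚ.+ η → U ℚ.* η ≡ δ →
            c ℚ.* U ℚ.≤ X ℚ.* s → s ℚ.≤ t → 1ℚ ℚ.≤ t → e ℚ.* U ℚ.≤ (X ℚ.+ δ) ℚ.* t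
  ≤-slack {e} {c} {η} {U} {δ} {X} {s} {t} 0≤U 0≤X 0≤δ e≤c+η Uη≡δ cU≤Xs s≤t 1≤t = begin
    e ℚ.* U                       ≤⟨ ℚ.*-monoʳ-≤-nonNeg U {{ℚ.nonNegative 0≤U}} e≤c+η ⟩
    (c ℚ.+ η) ℚ.* U               ≡⟨ ℚ.*-distribʳ-+ U c η ⟩
    c ℚ.* U ℚ.+ η ℚ.* U           ≡⟨ cong (c ℚ.* U ℚ.+_) (trans (ℚ.*-comm η U) Uη≡δ) ⟩
    c ℚ.* U ℚ.+ δ                 ≡⟨ cong (c ℚ.* U ℚ.+_) (ℚ.*-identityʳ δ) ⟨
    c ℚ.* U ℚ.+ δ ℚ.* 1ℚ          ≤⟨ ℚ.+-mono-≤ cU≤Xs (ℚ.*-monoˡ-≤-nonNeg δ {{ℚ.nonNegative 0≤δ}} 1≤t) ⟩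
    X ℚ.* s ℚ.+ δ ℚ.* t           ≤⟨ ℚ.+-monoˡ-≤ (δ ℚ.* t) (ℚ.*-monoˡ-≤-nonNeg X {{ℚ.nonNegative 0≤X}} s≤t) ⟩
    X ℚ.* t ℚ.+ δ ℚ.* t           ≡⟨ ℚ.*-distribʳ-+ t X δ ⟨
    (X ℚ.+ δ) ℚ.* t               ∎
    where open ℚ.≤-Reasoning

  0<1ℚ : 0ℚ ℚ.< 1ℚ
  0<1ℚ = ℚ.positive⁻¹ 1ℚ

  expansion-bound : ∀ {ε u x} n .{{_ : NonTrivial n}} → ε ≤ℝ fromℚ (+ 1 ℚ./ 2 ^ 5) → 1 ≤ u →
                    u ≤ 32 * (x * (⌊log₂ n ⌋ * ⌊log₂ n ⌋)) →
                    ε *ℝ fromℕ u /log² n ≤ℝ fromℕ x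
  expansion-bound {ε} {u} {x} n ε≤ 1≤u u≤ δ 0<δ = K , bound
    where
    -- The real bound on `ε` gives its approximations only up to `η`; taking `η` as δ/u makes the
    -- error after multiplication by `u` exactly `δ`.
    slack = split (ℕ⇒ℚ u) δ (ℚ.<-≤-trans 0<1ℚ (ℕ⇒ℚ-mono-≤ 1≤u)) 0<δ
    η = proj₁ slack
    ε≤c+η = ε≤ η (proj₁ (proj₂ slack))
    K = proj₁ ε≤c+η
    Λ = ⌊log₂ n ⌋

    log²≥ : ∀ k → ℕ⇒ℚ (Λ * Λ) ℚ.≤ approx (log² n) k
    log²≥ k = subst (ℚ._≤ approx (log² n) k) (sym (ℕ⇒ℚ-* Λ Λ))
      (*-mono-≤-nonNeg (0≤ℕ⇒ℚ Λ) (ℚ.≤-trans (0≤ℕ⇒ℚ Λ) (⌊log₂⌋≤log₂ n k)) (⌊log₂⌋≤log₂ n k) (⌊log₂⌋≤log₂ n k))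

    bound : ∀ {k} → K ≤ k → approx (ε *ℝ fromℕ u /log² n) k ℚ.≤ approx (fromℕ x) k ℚ.+ δ
    bound {k} K≤k = *-1/-≤ {p = approx ε k ℚ.* ℕ⇒ℚ u} {q = ℕ⇒ℚ x ℚ.+ δ} t {{ℚ.pos⇒nonZero t {{pos 0<t}}}} 0<t
      (≤-slack {c = + 1 ℚ./ 2 ^ 5} {s = ℕ⇒ℚ (Λ * Λ)} (0≤ℕ⇒ℚ u) (0≤ℕ⇒ℚ x) (ℚ.<⇒≤ 0<δ) (proj₂ ε≤c+η K≤k) (proj₂ (proj₂ slack))
        -- The bound 1/32 on `ε` cancels the 32 of the sparsity condition; `refl` checks this by
        -- computation.
        (sparse-ratio {c = + 1 ℚ./ 2 ^ 5} {u = u} {x} {Λ * Λ} 32 (ℚ.nonNegative⁻¹ (+ 1 ℚ./ 2 ^ 5)) refl u≤)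
        (ℚ.≤-trans (log²≥ k) (ℚ.p≤p⊔q _ 1ℚ)) (ℚ.p≤q⊔p (approx (log² n) k) 1ℚ))
      where
      -- This is the denominator that `1/ℝ` inverts: the cut-off is the witness 1 supplied by
      -- `0<log²`.
      t = approx (log² n) k ℚ.⊔ 1ℚ
      0<t : 0ℚ ℚ.< t
      0<t = ℚ.<-≤-trans 0<1ℚ (ℚ.p≤q⊔p (approx (log² n) k) 1ℚ)

open RealBounds

-- Counting in subsets, lists and concatenated families.

∣p∪q∣≤∣p∣+∣q∣ : ∀ {m} (p q : Subset m) → ∣ p ∪ q ∣ ≤ ∣ p ∣ + ∣ q ∣
∣p∪q∣≤∣p∣+∣q∣ []            []            = z≤n
∣p∪q∣≤∣p∣+∣q∣ (outside ∷ p) (outside ∷ q) = ∣p∪q∣≤∣p∣+∣q∣ p q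
∣p∪q∣≤∣p∣+∣q∣ (outside ∷ p) (inside  ∷ q) = ≤-trans (s≤s (∣p∪q∣≤∣p∣+∣q∣ p q)) (≤-reflexive (sym (+-suc ∣ p ∣ ∣ q ∣)))
∣p∪q∣≤∣p∣+∣q∣ (inside  ∷ p) (outside ∷ q) = s≤s (∣p∪q∣≤∣p∣+∣q∣ p q)
∣p∪q∣≤∣p∣+∣q∣ (inside  ∷ p) (inside  ∷ q) = s≤s (≤-trans (∣p∪q∣≤∣p∣+∣q∣ p q) (+-monoʳ-≤ ∣ p ∣ (n≤1+n ∣ q ∣)))

q⊆p⇒∣q∣+∣p─q∣≡∣p∣ : ∀ {m} {p q : Subset m} → q ⊆ p → ∣ q ∣ + ∣ p ─ q ∣ ≡ ∣ p ∣
q⊆p⇒∣q∣+∣p─q∣≡∣p∣ {p = []}          {[]}          _   = refl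
q⊆p⇒∣q∣+∣p─q∣≡∣p∣ {p = outside ∷ p} {outside ∷ q} q⊆p = q⊆p⇒∣q∣+∣p─q∣≡∣p∣ (drop-∷-⊆ q⊆p)
q⊆p⇒∣q∣+∣p─q∣≡∣p∣ {p = outside ∷ p} {inside  ∷ q} q⊆p = contradiction (q⊆p Vec.here) λ ()
q⊆p⇒∣q∣+∣p─q∣≡∣p∣ {p = inside  ∷ p} {outside ∷ q} q⊆p = trans (+-suc ∣ q ∣ _) (cong suc (q⊆p⇒∣q∣+∣p─q∣≡∣p∣ (drop-∷-⊆ q⊆p)))
q⊆p⇒∣q∣+∣p─q∣≡∣p∣ {p = inside  ∷ p} {inside  ∷ q} q⊆p = cong suc (q⊆p⇒∣q∣+∣p─q∣≡∣p∣ (drop-∷-⊆ q⊆p))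

length-filter-⊎ : ∀ {A : Set} {P Q R : A → Set} (P? : ∀ x → Dec (P x)) (Q? : ∀ x → Dec (Q x)) (R? : ∀ x → Dec (R x)) →
                  (∀ x → P x → Q x ⊎ R x) → ∀ xs →
                  length (filter P? xs) ≤ length (filter Q? xs) + length (filter R? xs)
length-filter-⊎ P? Q? R? f []       = z≤n
length-filter-⊎ P? Q? R? f (x ∷ xs) with P? x | Q? x | R? x | length-filter-⊎ P? Q? R? f xs
... | no  _ | no  _ | no  _ | ih = ih
... | no  _ | no  _ | yes _ | ih = ≤-trans ih (+-monoʳ-≤ _ (n≤1+n _))
... | no  _ | yes _ | no  _ | ih = m≤n⇒m≤1+n ih
... | no  _ | yes _ | yes _ | ih = m≤n⇒m≤1+n (≤-trans ih (+-monoʳ-≤ _ (n≤1+n _)))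
... | yes _ | yes _ | no  _ | ih = s≤s ih
... | yes _ | yes _ | yes _ | ih = s≤s (≤-trans ih (+-monoʳ-≤ _ (n≤1+n _)))
... | yes _ | no  _ | yes _ | ih = ≤-trans (s≤s ih) (≤-reflexive (sym (+-suc _ _)))
... | yes p | no ¬q | no ¬r | _  = contradiction (f x p) [ ¬q , ¬r ]′

sum-splitAt : ∀ r₁ {r₂} (f : Fin r₁ → ℕ) (g : Fin r₂ → ℕ) → sum ([ f , g ]′ ∘ splitAt r₁) ≡ sum f + sum g
sum-splitAt zero     f g = refl
sum-splitAt (suc r₁) f g = begin
  f zero + sum (λ i → [ f , g ]′ (splitAt (suc r₁) (suc i)))  ≡⟨ cong (_+_ (f zero)) (sum-cong-≗ tail-≗) ⟩
  f zero + sum ([ f ∘ suc , g ]′ ∘ splitAt r₁)                ≡⟨ cong (_+_ (f zero)) (sum-splitAt r₁ (f ∘ suc) g) ⟩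
  f zero + (sum (f ∘ suc) + sum g)                            ≡⟨ +-assoc (f zero) _ _ ⟨
  f zero + sum (f ∘ suc) + sum g                              ∎
  where
  open ≡-Reasoning
  tail-≗ : ∀ i → [ f , g ]′ (splitAt (suc r₁) (suc i)) ≡ [ f ∘ suc , g ]′ (splitAt r₁ i)
  tail-≗ i with splitAt r₁ i
  ... | inj₁ _ = refl
  ... | inj₂ _ = refl

T-not : ∀ {b} → ¬ T b → T (not b)
T-not {false} _  = tt
T-not {true}  ¬t = contradiction tt ¬t

T-not⁻ : ∀ {b} → T (not b) → ¬ T b
T-not⁻ {false} _ ()

-- Edge sets and the gluing of edge decompositions.

module _ {m : ℕ} where

  ∅ᴱ : EdgeSet m
  ∅ᴱ = record { adj = λ _ _ → false ; adj-sym = λ _ _ → refl ; adj-irrefl = λ _ → refl }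

  infixr 6 _∪ᴱ_

  _∪ᴱ_ : EdgeSet m → EdgeSet m → EdgeSet m
  E ∪ᴱ F = record
    { adj        = λ u v → adj E u v ∨ adj F u v
    ; adj-sym    = λ u v → cong₂ _∨_ (adj-sym E u v) (adj-sym F u v)
    ; adj-irrefl = λ v → cong₂ _∨_ (adj-irrefl E v) (adj-irrefl F v)
    }

  restrict : (E : EdgeSet m) {R : Fin m → Fin m → Set} → Decidable R → Symmetric R → EdgeSet m
  restrict E R? R-sym = record
    { adj        = λ u v → adj E u v ∧ does (R? u v)
    ; adj-sym    = λ u v → cong₂ _∧_ (adj-sym E u v) (does-⇔ (mk⇔ R-sym R-sym) (R? u v) (R? v u))
    ; adj-irrefl = λ v → cong (_∧ does (R? v v)) (adj-irrefl E v)
    }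

  module _ (E : EdgeSet m) {R : Fin m → Fin m → Set} (R? : Decidable R) {u v : Fin m} where

    restrict⁺ : Adj E u v → R u v → T (adj E u v ∧ does (R? u v))
    restrict⁺ e r = Equivalence.from T-∧ (e , subst T (sym (dec-true (R? u v) r)) tt)

    restrict⁻ : T (adj E u v ∧ does (R? u v)) → Adj E u v × R u v
    restrict⁻ a with R? u v | Equivalence.to (T-∧ {adj E u v}) a
    ... | yes r | e , _ = e , r

  module _ (E F : EdgeSet m) {u v : Fin m} where

    ∖ᴱ⁺ : Adj E u v → ¬ Adj F u v → Adj (E ∖ᴱ F) u v
    ∖ᴱ⁺ e ¬f = Equivalence.from T-∧ (e , T-not ¬f)

    ∖ᴱ⁻ : Adj (E ∖ᴱ F) u v → Adj E u v × ¬ Adj F u v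
    ∖ᴱ⁻ a = map₂ T-not⁻ (Equivalence.to (T-∧ {adj E u v}) a)

    ∪ᴱ⁺ : Adj E u v ⊎ Adj F u v → Adj (E ∪ᴱ F) u v
    ∪ᴱ⁺ = Equivalence.from T-∨

    ∪ᴱ⁻ : Adj (E ∪ᴱ F) u v → Adj E u v ⊎ Adj F u v
    ∪ᴱ⁻ = Equivalence.to (T-∨ {adj E u v})

  ∣∣ᴱ-⊎ : ∀ (E F F′ : EdgeSet m) → (∀ u v → Adj E u v → Adj F u v ⊎ Adj F′ u v) → ∣ E ∣ᴱ ≤ ∣ F ∣ᴱ + ∣ F′ ∣ᴱ
  ∣∣ᴱ-⊎ E F F′ cover = length-filter-⊎ _ _ _
    (λ (u , v) (u<v , e) → Sum.map (u<v ,_) (u<v ,_) (cover u v e)) (cartesianProduct (allFin m) (allFin m))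

  ∣∅ᴱ∣≡0 : ∣ ∅ᴱ ∣ᴱ ≡ 0
  ∣∅ᴱ∣≡0 = cong length (filter-none _ (All.universal (λ { _ (_ , ()) }) (cartesianProduct (allFin m) (allFin m))))

  ∣∣ᴱ-mono : ∀ (E F : EdgeSet m) → E ⊆ᴱ F → ∣ E ∣ᴱ ≤ ∣ F ∣ᴱ
  ∣∣ᴱ-mono E F E⊆F = begin
    ∣ E ∣ᴱ            ≤⟨ ∣∣ᴱ-⊎ E F ∅ᴱ (λ u v e → inj₁ (E⊆F u v e)) ⟩
    ∣ F ∣ᴱ + ∣ ∅ᴱ ∣ᴱ  ≡⟨ cong (_+_ (∣ F ∣ᴱ)) ∣∅ᴱ∣≡0 ⟩
    ∣ F ∣ᴱ + 0        ≡⟨ +-identityʳ _ ⟩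
    ∣ F ∣ᴱ            ∎
    where open ≤-Reasoning

  ∣∪ᴱ∣≤ : ∀ (E F : EdgeSet m) → ∣ E ∪ᴱ F ∣ᴱ ≤ ∣ E ∣ᴱ + ∣ F ∣ᴱ
  ∣∪ᴱ∣≤ E F = ∣∣ᴱ-⊎ (E ∪ᴱ F) E F (λ _ _ → ∪ᴱ⁻ E F)

  record Decomposition (P : Graph m → Set) (G : Graph m) : Set where
    field
      deleted     : EdgeSet m
      deleted⊆    : deleted ⊆ᴱ edges G
      size        : ℕ
      part        : Vector (Graph m) size
      isPartition : IsEdgePartition (G -ᴱ deleted) part
      part-P      : ∀ i → P (part i)

    totalOrder : ℕ
    totalOrder = sum (λ i → ∣ part i ∣ᴳ)

  open Decomposition

  whole : ∀ {P G} → P G → Decomposition P G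
  whole {P} {G} pG = record
    { deleted     = ∅ᴱ
    ; deleted⊆    = λ _ _ ()
    ; size        = 1
    ; part        = λ _ → G
    ; isPartition = (λ _ → (λ v∈ → v∈) , λ _ _ e → ∖ᴱ⁺ (edges G) ∅ᴱ e λ ())
                  , λ _ _ e → zero , proj₁ (∖ᴱ⁻ (edges G) ∅ᴱ e) , λ { {zero} _ → refl }
    ; part-P      = λ _ → pG
    }

  module _ {P : Graph m → Set} {G G₁ G₂ : Graph m} (C : EdgeSet m)
           (C⊆ : C ⊆ᴱ edges G) (G₁⊆ : G₁ ⊆ᴳ G) (G₂⊆ : G₂ ⊆ᴳ G)
           (cover : ∀ {u v} → Adj (edges G) u v → Adj C u v ⊎ Adj (edges G₁) u v ⊎ Adj (edges G₂) u v)
           (C∥G₁ : ∀ {u v} → Adj C u v → ¬ Adj (edges G₁) u v)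
           (C∥G₂ : ∀ {u v} → Adj C u v → ¬ Adj (edges G₂) u v)
           (G₁∥G₂ : ∀ {u v} → Adj (edges G₁) u v → ¬ Adj (edges G₂) u v)
           (d₁ : Decomposition P G₁) (d₂ : Decomposition P G₂) where

    private
      D₁ = deleted d₁
      D₂ = deleted d₂
      D = C ∪ᴱ D₁ ∪ᴱ D₂

      D⁻ : ∀ {u v} → Adj D u v → Adj C u v ⊎ Adj D₁ u v ⊎ Adj D₂ u v
      D⁻ = Sum.map₂ (∪ᴱ⁻ D₁ D₂) ∘ ∪ᴱ⁻ C (D₁ ∪ᴱ D₂)

      D⁺ : ∀ {u v} → Adj C u v ⊎ Adj D₁ u v ⊎ Adj D₂ u v → Adj D u v
      D⁺ = ∪ᴱ⁺ C (D₁ ∪ᴱ D₂) ∘ Sum.map₂ (∪ᴱ⁺ D₁ D₂)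

      part⊎ : Fin (size d₁) ⊎ Fin (size d₂) → Graph m
      part⊎ = [ part d₁ , part d₂ ]′

      part₁⁻ : ∀ {u v} i → Adj (edges (part d₁ i)) u v → Adj (edges G₁) u v × ¬ Adj D₁ u v
      part₁⁻ {u} {v} i = ∖ᴱ⁻ (edges G₁) D₁ ∘ proj₂ (proj₁ (isPartition d₁) i) u v

      part₂⁻ : ∀ {u v} i → Adj (edges (part d₂ i)) u v → Adj (edges G₂) u v × ¬ Adj D₂ u v
      part₂⁻ {u} {v} i = ∖ᴱ⁻ (edges G₂) D₂ ∘ proj₂ (proj₁ (isPartition d₂) i) u v

      -- An edge of a part from one side avoids `C` and its own side's deletions directly. It avoids
      -- the other side's deletions because those lie in the other, edge-disjoint subgraph.
      part⊎-⊆ : ∀ s → part⊎ s ⊆ᴳ G -ᴱ D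
      part⊎-⊆ (inj₁ i) = (λ v∈ → proj₁ G₁⊆ (proj₁ (proj₁ (isPartition d₁) i) v∈)) , λ u v e →
        let e₁ , ¬d₁ = part₁⁻ i e in
        ∖ᴱ⁺ (edges G) D (proj₂ G₁⊆ u v e₁) λ d →
          [ (λ c → C∥G₁ c e₁) , [ ¬d₁ , (λ d₂′ → G₁∥G₂ e₁ (deleted⊆ d₂ u v d₂′)) ]′ ]′ (D⁻ d)
      part⊎-⊆ (inj₂ i) = (λ v∈ → proj₁ G₂⊆ (proj₁ (proj₁ (isPartition d₂) i) v∈)) , λ u v e →
        let e₂ , ¬d₂ = part₂⁻ i e in
        ∖ᴱ⁺ (edges G) D (proj₂ G₂⊆ u v e₂) λ d →
          [ (λ c → C∥G₂ c e₂) , [ (λ d₁′ → G₁∥G₂ (deleted⊆ d₁ u v d₁′) e₂) , ¬d₂ ]′ ]′ (D⁻ d)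

      -- A surviving edge is not in `C`, so it belongs to one of the two subgraphs, whose own
      -- partition gives the part. Parts from the other side are excluded by edge-disjointness.
      part⊎-! : ∀ u v → Adj (edges (G -ᴱ D)) u v → ∃! _≡_ λ s → Adj (edges (part⊎ s)) u v
      part⊎-! u v e with e∈G , e∉D ← ∖ᴱ⁻ (edges G) D e | cover e∈G
      ... | inj₁ c = contradiction (D⁺ (inj₁ c)) e∉D
      ... | inj₂ (inj₁ e₁) =
        let i , a , ! = proj₂ (isPartition d₁) u v (∖ᴱ⁺ (edges G₁) D₁ e₁ (e∉D ∘ D⁺ ∘ inj₂ ∘ inj₁)) in
        inj₁ i , a , λ { {inj₁ j} b → cong inj₁ (! b)
                       ; {inj₂ j} b → contradiction (proj₁ (part₂⁻ j b)) (G₁∥G₂ e₁) }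
      ... | inj₂ (inj₂ e₂) =
        let i , a , ! = proj₂ (isPartition d₂) u v (∖ᴱ⁺ (edges G₂) D₂ e₂ (e∉D ∘ D⁺ ∘ inj₂ ∘ inj₂)) in
        inj₂ i , a , λ { {inj₁ j} b → contradiction e₂ (G₁∥G₂ (proj₁ (part₁⁻ j b)))
                       ; {inj₂ j} b → cong inj₂ (! b) }

      part⊎-P : ∀ s → P (part⊎ s)
      part⊎-P (inj₁ i) = part-P d₁ i
      part⊎-P (inj₂ i) = part-P d₂ i

      split₁ : Fin (size d₁ + size d₂) → Fin (size d₁) ⊎ Fin (size d₂)
      split₁ = splitAt (size d₁)

      combined : Decomposition P G
      combined = record
        { deleted     = D
        ; deleted⊆    = λ u v d → [ C⊆ u v , [ proj₂ G₁⊆ u v ∘ deleted⊆ d₁ u v , proj₂ G₂⊆ u v ∘ deleted⊆ d₂ u v ]′ ]′ (D⁻ d)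
        ; size        = size d₁ + size d₂
        ; part        = part⊎ ∘ split₁
        ; isPartition = part⊎-⊆ ∘ split₁ , λ u v e →
            let s , a , ! = part⊎-! u v e in
            join _ _ s
            , subst (λ s → Adj (edges (part⊎ s)) u v) (sym (Fin.splitAt-join _ _ s)) a
            , λ {j} b → trans (cong (join _ _) (! {split₁ j} b)) (Fin.join-splitAt (size d₁) (size d₂) j)
        ; part-P      = part⊎-P ∘ split₁
        }

      totalOrder-combined : totalOrder combined ≡ totalOrder d₁ + totalOrder d₂
      totalOrder-combined = trans (sum-cong-≗ (λ j → commute (split₁ j))) (sum-splitAt (size d₁) _ _)
        where
        commute : ∀ s → ∣ part⊎ s ∣ᴳ ≡ [ (λ i → ∣ part d₁ i ∣ᴳ) , (λ i → ∣ part d₂ i ∣ᴳ) ]′ s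
        commute (inj₁ _) = refl
        commute (inj₂ _) = refl

    combine : Σ[ d ∈ Decomposition P G ] totalOrder d ≡ totalOrder d₁ + totalOrder d₂ ×
                                         ∣ deleted d ∣ᴱ ≤ ∣ C ∣ᴱ + (∣ deleted d₁ ∣ᴱ + ∣ deleted d₂ ∣ᴱ)
    combine = combined , totalOrder-combined ,
      ≤-trans (∣∪ᴱ∣≤ C (D₁ ∪ᴱ D₂)) (+-monoʳ-≤ ∣ C ∣ᴱ (∣∪ᴱ∣≤ D₁ D₂))

  -- Cutting a graph along a set and its remaining neighbourhood.

  module _ (G : Graph m) (U X : Subset m) where

    -- `Near` demands an end in `U`, so an edge inside `X` but avoiding `U` is `Far`. The two pieces
    -- thus stay edge-disjoint while sharing only vertices of `X`.
    Crossing Near Far : Fin m → Fin m → Set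
    Crossing u v = (u ∈ U × v ∉ U ∪ X) ⊎ (v ∈ U × u ∉ U ∪ X)
    Near     u v = (u ∈ U ⊎ v ∈ U) × u ∈ U ∪ X × v ∈ U ∪ X
    Far      u v = u ∉ U × v ∉ U

    crossing? : Decidable Crossing
    crossing? u v = ((u ∈? U) ×-dec ¬? (v ∈? U ∪ X)) ⊎-dec ((v ∈? U) ×-dec ¬? (u ∈? U ∪ X))

    near? : Decidable Near
    near? u v = ((u ∈? U) ⊎-dec (v ∈? U)) ×-dec (u ∈? U ∪ X) ×-dec (v ∈? U ∪ X)

    far? : Decidable Far
    far? u v = ¬? (u ∈? U) ×-dec ¬? (v ∈? U)

    crossingEdges : EdgeSet m
    crossingEdges = restrict (edges G) crossing? Sum.swap

    nearGraph : Graph m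
    nearGraph = record
      { vertices = vertices G ∩ (U ∪ X)
      ; edges    = restrict (edges G) near? (λ (o , u∈ , v∈) → Sum.swap o , v∈ , u∈)
      ; incident = λ u v a → let e , _ , u∈ , _ = restrict⁻ (edges G) near? a in x∈p∩q⁺ (incident G u v e , u∈)
      }

    farGraph : Graph m
    farGraph = record
      { vertices = vertices G ─ U
      ; edges    = restrict (edges G) far? swap
      ; incident = λ u v a → let e , u∉ , _ = restrict⁻ (edges G) far? a in x∈p∧x∉q⇒x∈p─q (incident G u v e) u∉
      }

    trichotomy : ∀ u v → Crossing u v ⊎ Near u v ⊎ Far u v
    trichotomy u v with u ∈? U | v ∈? U | u ∈? U ∪ X | v ∈? U ∪ X
    ... | no u∉  | no v∉  | _       | _       = inj₂ (inj₂ (u∉ , v∉))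
    ... | yes u∈ | _      | _       | no v∉W  = inj₁ (inj₁ (u∈ , v∉W))
    ... | yes u∈ | _      | _       | yes v∈W = inj₂ (inj₁ (inj₁ u∈ , p⊆p∪q X u∈ , v∈W))
    ... | no _   | yes v∈ | no u∉W  | _       = inj₁ (inj₂ (v∈ , u∉W))
    ... | no _   | yes v∈ | yes u∈W | _       = inj₂ (inj₁ (inj₂ v∈ , u∈W , p⊆p∪q X v∈))

    split-decomposition : ∀ {P} (d₁ : Decomposition P nearGraph) (d₂ : Decomposition P farGraph) →
      Σ[ d ∈ Decomposition P G ] totalOrder d ≡ totalOrder d₁ + totalOrder d₂ ×
                                 ∣ deleted d ∣ᴱ ≤ ∣ crossingEdges ∣ᴱ + (∣ deleted d₁ ∣ᴱ + ∣ deleted d₂ ∣ᴱ)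
    split-decomposition = combine crossingEdges
      (λ _ _ → proj₁ ∘ restrict⁻ E crossing?)
      (p∩q⊆p _ _ , λ _ _ → proj₁ ∘ restrict⁻ E near?)
      (p─q⊆p _ _ , λ _ _ → proj₁ ∘ restrict⁻ E far?)
      (λ {u} {v} e → Sum.map (restrict⁺ E crossing? e) (Sum.map (restrict⁺ E near? e) (restrict⁺ E far? e)) (trichotomy u v))
      (λ c n → let _ , _ , u∈ , v∈ = restrict⁻ E near? n in
         [ (λ (_ , v∉) → v∉ v∈) , (λ (_ , u∉) → u∉ u∈) ]′ (proj₂ (restrict⁻ E crossing? c)))
      (λ c f → let _ , u∉ , v∉ = restrict⁻ E far? f in
         [ (λ (u∈ , _) → u∉ u∈) , (λ (v∈ , _) → v∉ v∈) ]′ (proj₂ (restrict⁻ E crossing? c)))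
      (λ n f → let _ , u∉ , v∉ = restrict⁻ E far? f in
         [ u∉ , v∉ ]′ (proj₁ (proj₂ (restrict⁻ E near? n))))
      where
      E = edges G

  ∈-N : ∀ (G : Graph m) {U u v} → v ∈ vertices G → v ∉ U → u ∈ U → Adj (edges G) u v → v ∈ N G U
  ∈-N G {U} {u} {v} v∈ v∉ u∈ e = lookup⇒[]= v (N G U) (trans (lookup∘tabulate _ v)
    (dec-true ((v ∈? vertices G) ×-dec ¬? (v ∈? U) ×-dec Fin.any? λ u → (u ∈? U) ×-dec T? (adj (edges G) u v))
              (v∈ , v∉ , u , u∈ , e)))

  -- Searching for bad expansion, and the recursion.

  module _ (s : ℕ) where

    -- Ranging over X instead of F makes the search finite: the cheapest F that
    -- leaves U with neighbourhood inside X consists of the crossing edges.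
    Violation : Graph m → Subset m → Subset m → Set
    Violation G U X = U ⊆ vertices G × 1 ≤ ∣ U ∣ × 3 * ∣ U ∣ ≤ 2 * ∣ G ∣ᴳ ×
                      32 * (∣ X ∣ * (⌊log₂ ∣ G ∣ᴳ ⌋ * ⌊log₂ ∣ G ∣ᴳ ⌋)) < ∣ U ∣ ×
                      ∣ crossingEdges G U X ∣ᴱ ≤ s * ∣ U ∣

    violation? : ∀ G → Dec (∃[ U ] ∃[ X ] Violation G U X)
    violation? G = anySubset? λ U → anySubset? λ X →
      (U ⊆? vertices G) ×-dec (1 ≤? ∣ U ∣) ×-dec (3 * ∣ U ∣ ≤? 2 * ∣ G ∣ᴳ) ×-dec
      (32 * (∣ X ∣ * (⌊log₂ ∣ G ∣ᴳ ⌋ * ⌊log₂ ∣ G ∣ᴳ ⌋)) <? ∣ U ∣) ×-dec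
      (∣ crossingEdges G U X ∣ᴱ ≤? s * ∣ U ∣)

    -- If an edge from `U` survives the removal of `F`, its other end is in `U` or in the remaining
    -- neighbourhood. An edge that leaves both was therefore in `F`.
    crossing-N⊆ : ∀ (G : Graph m) U F → crossingEdges G U (N (G -ᴱ F) U) ⊆ᴱ F
    crossing-N⊆ G U F u v c = go (restrict⁻ (edges G) (crossing? G U X) c)
      where
      X = N (G -ᴱ F) U
      escape : ∀ {a b} → Adj (edges G) a b → a ∈ U → b ∉ U ∪ X → Adj F a b
      escape {a} {b} e a∈ b∉ with T? (adj F a b)
      ... | yes f = f
      ... | no ¬f = contradiction (q⊆p∪q U X (∈-N (G -ᴱ F) (incident G b a (subst T (adj-sym (edges G) a b) e))
                      (b∉ ∘ p⊆p∪q X) a∈ (∖ᴱ⁺ (edges G) F e ¬f))) b∉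
      go : Adj (edges G) u v × Crossing G U X u v → Adj F u v
      go (e , inj₁ (u∈ , v∉)) = escape e u∈ v∉
      go (e , inj₂ (v∈ , u∉)) = subst T (adj-sym F v u) (escape (subst T (adj-sym (edges G) u v) e) v∈ u∉)

    module _ (ε : ℝ) (ε≤ : ε ≤ℝ fromℚ (+ 1 / 2 ^ 5)) where

      -- Taking `X` to be the neighbourhood after removing `F`, the crossing edges number at most
      -- |F|, so only sparsity can fail. Its failure is the hypothesis of `expansion-bound`.
      no-violation⇒expander : ∀ G → ¬ (∃[ U ] ∃[ X ] Violation G U X) → IsExpander ε s G
      no-violation⇒expander G none U F U⊆ F⊆ 1≤u 3u≤2n F≤ =
        expansion-bound {ε} {∣ U ∣} {∣ N (G -ᴱ F) U ∣} ∣ G ∣ᴳ {{bounds⇒nonTrivial 1≤u 3u≤2n}} ε≤ 1≤u (≮⇒≥ λ sparse →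
          none (U , N (G -ᴱ F) U , U⊆ , 1≤u , 3u≤2n , sparse ,
            ≤-trans (∣∣ᴱ-mono (crossingEdges G U (N (G -ᴱ F) U)) F (crossing-N⊆ G U F)) F≤))

      -- The scale `M` is quantified in the order bound so that both pieces can be measured with the
      -- scale of the graph they came from.
      record ExpanderDecomposition (G : Graph m) : Set where
        field
          decomposition : Decomposition (IsExpander ε s) G
          deleted≤      : ∣ deleted decomposition ∣ᴱ ≤ s * (4 * logTotal ∣ G ∣ᴳ)
          totalOrder≤   : ∀ {M} → (∀ {l} → 1 ≤ l → l ≤ suc ⌊log₂ ∣ G ∣ᴳ ⌋ → l ∣ M) →
                          totalOrder decomposition * M ≤ orderTotal M ∣ G ∣ᴳ

      open ExpanderDecomposition

      decompose : ∀ G → Acc _<_ ∣ G ∣ᴳ → ExpanderDecomposition G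
      decompose G (acc rec) with violation? G
      ... | no none = record
        { decomposition = whole (no-violation⇒expander G none)
        ; deleted≤      = subst (_≤ s * (4 * logTotal ∣ G ∣ᴳ)) (sym ∣∅ᴱ∣≡0) z≤n
        ; totalOrder≤   = λ {M} _ → subst (λ k → k * M ≤ orderTotal M ∣ G ∣ᴳ) (sym (+-identityʳ ∣ G ∣ᴳ))
            (orderTotal≥ M ∣ G ∣ᴳ)
        }
      ... | yes (U , X , U⊆ , 1≤u , 3u≤2n , sparse , few) = record
        { decomposition = proj₁ d
        ; deleted≤      = begin
            ∣ deleted (proj₁ d) ∣ᴱ
              ≤⟨ proj₂ (proj₂ d) ⟩
            ∣ crossingEdges G U X ∣ᴱ + (∣ deleted (decomposition d₁) ∣ᴱ + ∣ deleted (decomposition d₂) ∣ᴱ)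
              ≤⟨ +-mono-≤ few (+-mono-≤ (deleted≤ d₁) (deleted≤ d₂)) ⟩
            s * u + (s * (4 * logTotal ∣ G₁ ∣ᴳ) + s * (4 * logTotal v))
              ≡⟨ solve 4 (λ s u a b → s :* u :+ (s :* (con 4 :* a) :+ s :* (con 4 :* b)) := s :* (u :+ con 4 :* (a :+ b)))
                   refl s u (logTotal ∣ G₁ ∣ᴳ) (logTotal v) ⟩
            s * (u + 4 * (logTotal ∣ G₁ ∣ᴳ + logTotal v))
              -- `X` may meet `U` or leave the vertex set, so the near piece has at most, not
              -- exactly, `u + x` vertices.
              ≤⟨ *-monoʳ-≤ s (+-monoʳ-≤ u (*-monoʳ-≤ 4 (+-monoˡ-≤ (logTotal v) (total-mono-≤ n₁≤u+x)))) ⟩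
            s * (u + 4 * (logTotal (u + x) + logTotal v))
              ≤⟨ *-monoʳ-≤ s (logTotal-split 3u≤2[u+v] 1≤Λ sparse′) ⟩
            s * (4 * logTotal (u + v))
              ≡⟨ cong (λ n → s * (4 * logTotal n)) u+v≡n ⟩
            s * (4 * logTotal ∣ G ∣ᴳ) ∎
        ; totalOrder≤   = λ {M} ∣M → begin
            totalOrder (proj₁ d) * M
              ≡⟨ cong (_* M) (proj₁ (proj₂ d)) ⟩
            (totalOrder (decomposition d₁) + totalOrder (decomposition d₂)) * M
              ≡⟨ *-distribʳ-+ M (totalOrder (decomposition d₁)) _ ⟩
            totalOrder (decomposition d₁) * M + totalOrder (decomposition d₂) * M
              -- The pieces are smaller, so their logarithms are no larger and the divisibility of
              -- `M` carries over.
              ≤⟨ +-mono-≤ (totalOrder≤ d₁ λ 1≤l l≤ → ∣M 1≤l (≤-trans l≤ (s≤s (⌊log₂⌋-mono-≤ (<⇒≤ n₁<n)))))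
                          (totalOrder≤ d₂ λ 1≤l l≤ → ∣M 1≤l (≤-trans l≤ (s≤s (⌊log₂⌋-mono-≤ (<⇒≤ v<n))))) ⟩
            orderTotal M ∣ G₁ ∣ᴳ + orderTotal M v
              ≤⟨ +-monoˡ-≤ (orderTotal M v) (total-mono-≤ n₁≤u+x) ⟩
            orderTotal M (u + x) + orderTotal M v
              ≤⟨ orderTotal-split 3u≤2[u+v] 1≤Λ sparse′
                   (λ {l} 1≤l l≤ → ∣M 1≤l (subst (λ n → l ≤ suc ⌊log₂ n ⌋) u+v≡n l≤)) ⟩
            orderTotal M (u + v)
              ≡⟨ cong (orderTotal M) u+v≡n ⟩
            orderTotal M ∣ G ∣ᴳ ∎
        }
        where
        open ≤-Reasoning
        open +-*-Solver
        G₁ = nearGraph G U X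
        G₂ = farGraph G U X
        u = ∣ U ∣
        x = ∣ X ∣
        v = ∣ G₂ ∣ᴳ

        u+v≡n : u + v ≡ ∣ G ∣ᴳ
        u+v≡n = q⊆p⇒∣q∣+∣p─q∣≡∣p∣ U⊆

        3u≤2[u+v] : 3 * u ≤ 2 * (u + v)
        3u≤2[u+v] = subst (λ n → 3 * u ≤ 2 * n) (sym u+v≡n) 3u≤2n

        1≤Λ : 1 ≤ ⌊log₂ (u + v) ⌋
        -- A nonempty `U` with at most two thirds of the vertices forces at least two vertices.
        1≤Λ = ⌊log₂⌋-mono-≤ {2} (nonTrivial⇒n>1 (u + v) {{bounds⇒nonTrivial 1≤u 3u≤2[u+v]}})

        sparse′ : 32 * (x * (⌊log₂ (u + v) ⌋ * ⌊log₂ (u + v) ⌋)) < u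
        sparse′ = subst (λ n → 32 * (x * (⌊log₂ n ⌋ * ⌊log₂ n ⌋)) < u) (sym u+v≡n) sparse

        n₁≤u+x : ∣ G₁ ∣ᴳ ≤ u + x
        n₁≤u+x = ≤-trans (∣p∩q∣≤∣q∣ (vertices G) (U ∪ X)) (∣p∪q∣≤∣p∣+∣q∣ U X)

        n₁<n : ∣ G₁ ∣ᴳ < ∣ G ∣ᴳ
        n₁<n = ≤-<-trans n₁≤u+x (subst (u + x <_) u+v≡n (split-< 3u≤2[u+v] 1≤Λ sparse′))

        v<n : v < ∣ G ∣ᴳ
        v<n = subst (v <_) u+v≡n (+-monoˡ-≤ v 1≤u)

        d₁ : ExpanderDecomposition G₁
        d₁ = decompose G₁ (rec n₁<n)

        d₂ : ExpanderDecomposition G₂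
        d₂ = decompose G₂ (rec v<n)

        d = split-decomposition G U X (decomposition d₁) (decomposition d₂)

-- Reading the stated bounds off the potentials.

lemma14 : ∀ {m} (G : Graph m) (s : ℕ) (ε : ℝ) → ε ≤ℝ fromℚ (+ 1 / 2 ^ 5) →
          let n = ∣ G ∣ᴳ in
          ∃[ D ] D ⊆ᴱ Graph.edges G × fromℕ ∣ D ∣ᴱ ≤ℝ fromℕ (4 * s * n) *ℝ log₂ n ×
          ∃[ r ] Σ[ H ∈ Vector (Graph m) r ]
            IsEdgePartition (G -ᴱ D) H ×
            sum (λ i → ∣ H i ∣ᴳ) ≤ 2 * n ×
            (∀ i → IsExpander ε s (H i))
lemma14 G s ε ε≤ =
  deleted d , deleted⊆ d , deletion-bound (4 * s * n) n deleted-few , size d , part d , isPartition d ,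
  *-cancelʳ-≤ (totalOrder d) (2 * n) M order-few , part-P d
  where
  open Decomposition
  open ≤-Reasoning
  open +-*-Solver
  n = ∣ G ∣ᴳ
  Λ = ⌊log₂ n ⌋
  -- The factorial of Λ + 1 is divisible by every `l` in the required range, and being nonzero it
  -- can be cancelled from the order bound.
  M = suc Λ !
  instance _ = suc Λ !≢0
  result = decompose s ε ε≤ G (<-wellFounded n)
  d = ExpanderDecomposition.decomposition result

  deleted-few : ∣ deleted d ∣ᴱ ≤ 4 * s * n * Λ
  deleted-few = begin
    ∣ deleted d ∣ᴱ        ≤⟨ ExpanderDecomposition.deleted≤ result ⟩
    s * (4 * logTotal n)  ≤⟨ *-monoʳ-≤ s (*-monoʳ-≤ 4 (logTotal≤ n)) ⟩
    s * (4 * (n * Λ))     ≡⟨ solve 3 (λ s n l → s :* (con 4 :* (n :* l)) := con 4 :* s :* n :* l) refl s n Λ ⟩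
    4 * s * n * Λ         ∎

  order-few : totalOrder d * M ≤ 2 * n * M
  order-few = begin
    totalOrder d * M  ≤⟨ ExpanderDecomposition.totalOrder≤ result ∣-! ⟩
    orderTotal M n    ≤⟨ orderTotal≤ M n ⟩
    n * (2 * M)       ≡⟨ solve 2 (λ n m → n :* (con 2 :* m) := con 2 :* n :* m) refl n M ⟩
    2 * n * M         ∎
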